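{- Let $k\ge 2$ and $n\ge 2k$ be integers. The Kneser graph $\mathrm{KG}(n,k)$ satisfies $\alpha_{\mathrm{od}}(\mathrm{KG}(n,k))=\alpha(\mathrm{KG}(n,k))$ if and only if $\binom{n-k-1}{k-1}$ is odd. Equivalently, $\alpha_{\mathrm{od}}(\mathrm{KG}(n,k))=\alpha(\mathrm{KG}(n,k))$ if and only if $\binom{n-1}{k-1}\not\equiv \sum_{t=1}^{k}\binom{k}{t}\binom{n-k-1}{k-1-t} \pmod 2$.
   Context: The Kneser graph $\mathrm{KG}(n,k)$ has as vertices the $k$-element subsets of an $n$-element set, two being adjacent iff they are disjoint. An odd independent set in a graph $G=(V,E)$ is an independent set $S$ such that every $v\in V\setminus S$ has either no neighbor or an odd number of neighbors in $S$. $\alpha_{\mathrm{od}}(G)$ is the maximum size of an odd independent set; $\alpha(G)$ is the independence number. -}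

module Defs where

open import Level using (0ℓ)
open import Data.Bool using (true; false)
open import Data.Empty using () renaming (⊥ to Empty-type)
open import Data.Fin using (Fin)
open import Data.Fin.Properties using (+↔⊎; 0↔⊥; 1↔⊤; all?; inj⇒≟)
open import Data.Fin.Subset using (Subset; inside; outside; _∩_; Empty; ∣_∣) renaming (_∈_ to _∈ₛ_; _∉_ to _∉ₛ_; ⊥ to ∅)
open import Data.Fin.Subset.Properties using (_∈?_; nonempty?; ∩-comm; ∣⊥∣≡0; ∉⊥; ∩-zeroʳ)
open import Data.Integer using (ℤ; +_; -[1+_])
open import Data.List using (List; []; _∷_; map; filter; applyUpTo; _++_)
open import Data.List.Extrema.Nat using (argmax; argmax-all; f[xs]≤f[argmax])
open import Data.List.Membership.Propositional using (_∈_)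
open import Data.List.Membership.Propositional.Properties using (∈-map⁺; ∈-++⁺ˡ; ∈-++⁺ʳ; ∈-filter⁺)
open import Data.List.Relation.Unary.All as All using ()
open import Data.List.Relation.Unary.All.Properties using (all-filter)
open import Data.List.Relation.Unary.Any using (here)
open import Data.Nat using (ℕ; zero; suc; _+_; _≤_)
open import Data.Nat.Combinatorics using (_C_)
open import Data.Nat.DivMod using (_%_)
open import Data.Nat.ListAction using (sum)
open import Data.Nat.Properties using (≡-irrelevant; suc-injective; _≟_)
open import Data.Product using (Σ; _,_; _×_; proj₁; ∃-syntax)
open import Data.Sum using (_⊎_; inj₁; inj₂)
open import Data.Sum.Function.Propositional using (_⊎-↔_)
open import Data.Unit using (tt)
open import Data.Vec using ([]; _∷_; tabulate)
open import Function using (_↔_; Inverse; mk↔ₛ′)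
open import Function.Construct.Composition using (_↔-∘_)
open import Function.Construct.Symmetry using (↔-sym)
open import Function.Properties.Inverse using (↔⇒↣)
open import Relation.Binary using (Rel; Symmetric; Irreflexive; Decidable; DecidableEquality)
open import Relation.Binary.PropositionalEquality using (_≡_; _≢_; refl; trans; cong; subst; ≢-sym)
import Relation.Unary as U
open import Relation.Nullary using (¬_; Dec; does; contradiction)
open import Relation.Nullary.Decidable using (map′; ¬?; _×-dec_; _⊎-dec_; _→-dec_)

Odd : ℕ → Set
Odd m = m % 2 ≡ 1

-- Binomial coefficient with an integer lower index; it vanishes when that
-- index is negative.
_Cᶻ_ : ℕ → ℤ → ℕ
m Cᶻ (+ j)    = m C j
m Cᶻ -[1+ _ ] = 0

∑[1⋯_] : ℕ → (ℕ → ℕ) → ℕ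
∑[1⋯ k ] f = sum (applyUpTo (λ i → f (suc i)) k)

allSubsets : ∀ n → List (Subset n)
allSubsets zero    = [] ∷ []
allSubsets (suc n) = map (inside ∷_) (allSubsets n) ++ map (outside ∷_) (allSubsets n)

∈-allSubsets : ∀ {n} (p : Subset n) → p ∈ allSubsets n
∈-allSubsets []          = here refl
∈-allSubsets (true ∷ p)  = ∈-++⁺ˡ (∈-map⁺ (inside ∷_) (∈-allSubsets p))
∈-allSubsets (false ∷ p) = ∈-++⁺ʳ _ (∈-map⁺ (outside ∷_) (∈-allSubsets p))

-- The size of a largest subset satisfying P, and 0 if there is none.
maxSize : ∀ {n} {P : U.Pred (Subset n) 0ℓ} → U.Decidable P → ℕ
maxSize {n} P? = ∣ argmax ∣_∣ ∅ (filter P? (allSubsets n)) ∣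

maxSize-upper : ∀ {n} {P : U.Pred (Subset n) 0ℓ} (P? : U.Decidable P) →
                ∀ {S} → P S → ∣ S ∣ ≤ maxSize P?
maxSize-upper {n} P? {S} PS =
  All.lookup (f[xs]≤f[argmax] ∅ (filter P? (allSubsets n)))
             (∈-filter⁺ P? (∈-allSubsets S) PS)

maxSize-attained : ∀ {n} {P : U.Pred (Subset n) 0ℓ} (P? : U.Decidable P) →
                   P ∅ → ∃[ S ] P S × ∣ S ∣ ≡ maxSize P?
maxSize-attained {n} P? P∅ =
  _ , argmax-all ∣_∣ P∅ (all-filter P? (allSubsets n)) , refl

record Graph : Set₁ where
  infix 4 _~_ _~?_
  field
    Vertex   : Set
    order    : ℕ
    indexing : Vertex ↔ Fin order
    _~_      : Rel Vertex 0ℓ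
    _~?_     : Decidable _~_
    ~-sym    : Symmetric _~_
    ~-irrefl : Irreflexive _≡_ _~_

  index : Vertex → Fin order
  index = Inverse.to indexing

  vertex : Fin order → Vertex
  vertex = Inverse.from indexing

  -- Sets of vertices are represented by the sets of their indices.
  VertexSet : Set
  VertexSet = Subset order

  infix 4 _∈ᵥ_ _∉ᵥ_
  _∈ᵥ_ _∉ᵥ_ : Vertex → VertexSet → Set
  v ∈ᵥ S = index v ∈ₛ S
  v ∉ᵥ S = index v ∉ₛ S

  allVertices? : ∀ {P : U.Pred Vertex 0ℓ} → U.Decidable P → Dec (∀ v → P v)
  allVertices? {P} P? =
    map′ (λ h v → subst P (Inverse.strictlyInverseʳ indexing v) (h (index v)))
         (λ h i → h (vertex i))
         (all? (λ i → P? (vertex i)))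

  neighbours : Vertex → VertexSet
  neighbours v = tabulate (λ i → does (v ~? vertex i))

  Independent : VertexSet → Set
  Independent S = ∀ u v → u ∈ᵥ S → v ∈ᵥ S → ¬ (u ~ v)

  OddIndependent : VertexSet → Set
  OddIndependent S =
    Independent S ×
    (∀ v → v ∉ᵥ S → ∣ neighbours v ∩ S ∣ ≡ 0 ⊎ Odd ∣ neighbours v ∩ S ∣)

  independent? : U.Decidable Independent
  independent? S = allVertices? λ u → allVertices? λ v →
    (index u ∈? S) →-dec ((index v ∈? S) →-dec ¬? (u ~? v))

  oddIndependent? : U.Decidable OddIndependent
  oddIndependent? S = independent? S ×-dec allVertices? λ v →
    ¬? (index v ∈? S) →-dec
    ((∣ neighbours v ∩ S ∣ ≟ 0) ⊎-dec (∣ neighbours v ∩ S ∣ % 2 ≟ 1))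

  ∅-independent : Independent ∅
  ∅-independent u v u∈∅ = contradiction u∈∅ ∉⊥

  ∅-oddIndependent : OddIndependent ∅
  ∅-oddIndependent = ∅-independent , λ v _ →
    inj₁ (trans (cong ∣_∣ (∩-zeroʳ (neighbours v))) (∣⊥∣≡0 order))

α : Graph → ℕ
α G = maxSize (Graph.independent? G)

α-od : Graph → ℕ
α-od G = maxSize (Graph.oddIndependent? G)

KSubset : ℕ → ℕ → Set
KSubset n k = Σ (Subset n) (λ p → ∣ p ∣ ≡ k)

KSubset-≡ : ∀ {n k} {p q : KSubset n k} → proj₁ p ≡ proj₁ q → p ≡ q
KSubset-≡ {p = p , e} {q = .p , f} refl = cong (p ,_) (≡-irrelevant e f)

-- Pascal's recursion, so that the bijection below can follow it.
#KSubset : ℕ → ℕ → ℕ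
#KSubset zero    zero    = 1
#KSubset zero    (suc k) = 0
#KSubset (suc n) zero    = #KSubset n zero
#KSubset (suc n) (suc k) = #KSubset n k + #KSubset n (suc k)

KSubset↔Fin : ∀ n k → KSubset n k ↔ Fin (#KSubset n k)
KSubset↔Fin zero zero = ↔-sym 1↔⊤ ↔-∘ mk↔ₛ′ (λ _ → tt) (λ _ → [] , refl)
  (λ _ → refl) (λ { ([] , refl) → refl })
KSubset↔Fin zero (suc k) = ↔-sym 0↔⊥ ↔-∘ mk↔ₛ′ absurd (λ ())
  (λ ()) (λ { ([] , ()) })
  where
  absurd : KSubset zero (suc k) → Empty-type
  absurd ([] , ())
KSubset↔Fin (suc n) zero = KSubset↔Fin n zero ↔-∘ mk↔ₛ′ to from
  (λ _ → refl) (λ { (false ∷ p , e) → refl ; (true ∷ p , ()) })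
  where
  to : KSubset (suc n) zero → KSubset n zero
  to (false ∷ p , e) = p , e
  to (true ∷ p , ())
  from : KSubset n zero → KSubset (suc n) zero
  from (p , e) = outside ∷ p , e
KSubset↔Fin (suc n) (suc k) =
  ↔-sym +↔⊎ ↔-∘ ((KSubset↔Fin n k ⊎-↔ KSubset↔Fin n (suc k)) ↔-∘ mk↔ₛ′ to from to∘from from∘to)
  where
  to : KSubset (suc n) (suc k) → KSubset n k ⊎ KSubset n (suc k)
  to (true ∷ p , e)  = inj₁ (p , suc-injective e)
  to (false ∷ p , e) = inj₂ (p , e)
  from : KSubset n k ⊎ KSubset n (suc k) → KSubset (suc n) (suc k)
  from (inj₁ (p , e)) = inside ∷ p , cong suc e
  from (inj₂ (p , e)) = outside ∷ p , e
  to∘from : ∀ x → to (from x) ≡ x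
  to∘from (inj₁ _) = cong inj₁ (KSubset-≡ refl)
  to∘from (inj₂ _) = refl
  from∘to : ∀ x → from (to x) ≡ x
  from∘to (true ∷ p , e)  = KSubset-≡ refl
  from∘to (false ∷ p , e) = refl

_≟ₖ_ : ∀ {n k} → DecidableEquality (KSubset n k)
_≟ₖ_ {n} {k} = inj⇒≟ (↔⇒↣ (KSubset↔Fin n k))

Disjoint : ∀ {n} → Subset n → Subset n → Set
Disjoint p q = Empty (p ∩ q)

-- The condition p ≢ q only matters for k = 0: for k ≥ 1 it follows from
-- disjointness.
KG : ℕ → ℕ → Graph
KG n k = record
  { Vertex   = KSubset n k
  ; order    = #KSubset n k
  ; indexing = KSubset↔Fin n k
  ; _~_      = λ p q → p ≢ q × Disjoint (proj₁ p) (proj₁ q)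
  ; _~?_     = λ p q → ¬? (p ≟ₖ q) ×-dec ¬? (nonempty? (proj₁ p ∩ proj₁ q))
  ; ~-sym    = λ { {p} {q} (p≢q , d) → ≢-sym p≢q , subst Empty (∩-comm (proj₁ p) (proj₁ q)) d }
  ; ~-irrefl = λ p≡q p~q → proj₁ p~q p≡q
  }

{-# OPTIONS --safe #-}

-- Hoffman's ratio bound on the Kneser graph.  For 2k ≤ n every function on the k-sets is
-- an orthogonal sum of pieces S ↦ ∑_{T ⊆ S} h(T), 0 ≤ j ≤ k, where h lives on the
-- j-sets and its sums over the j-supersets of any (j−1)-set vanish; counting over
-- disjoint sets multiplies such a piece by (−1)^j C(n−k−j, k−j) ≥ − C(n−k−1, k−1) for
-- j ≥ 1.  Expanding the indicator of an independent family bounds its size by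
-- C(n−1, k−1), and in the case of equality only j = 0 and the eigenvalue
-- − C(n−k−1, k−1) occur, so every k-set outside the family has exactly C(n−k−1, k−1)
-- neighbours in it.  Stars attain the bound, and the odd condition on any maximum
-- independent set becomes the parity of that binomial coefficient; no classification of
-- the maximum families is needed.  Vandermonde's identity gives the second criterion.
module Submission where

open import Defs
open import Data.Bool using (Bool; true; false; _∧_)
open import Data.Empty using (⊥-elim)
open import Data.Fin using (Fin; zero; suc)
open import Data.Fin.Subset using (Subset; ∣_∣; _∩_; Empty; Nonempty) renaming (⊥ to ∅; _∈_ to _∈ₛ_)
open import Data.Fin.Subset.Properties using (∣⊥∣≡0; _∈?_; nonempty?; x∈p∩q⁺; Empty-unique; ∩-idem)
open import Data.List using (applyUpTo)
open import Data.Nat.Combinatorics using (_C_; k>n⇒nCk≡0; nCk+nC[k+1]≡[n+1]C[k+1]; nCn≡1; nC1≡n; nCk≡nC[n∸k])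
open import Data.Nat.DivMod using (_%_; m%n<n; %-distribˡ-+)
open import Data.Nat.ListAction using (sum)
open import Data.Product using (_×_; _,_; proj₁; proj₂)
open import Data.Sum using (_⊎_; inj₁; inj₂; [_,_]′)
open import Data.Vec using ([]; _∷_; lookup; tabulate; head; _++_; splitAt; here; there)
open import Data.Vec.Properties using (lookup∘tabulate; lookup-zipWith; lookup-++ˡ; lookup-++ʳ; []=⇒lookup; lookup⇒[]=)
open import Function using (_∘_; id; mk⇔; Inverse; Equivalence)
open import Function.Bundles using (_⇔_)
open import Relation.Binary.Definitions using (tri<; tri≈; tri>)
open import Relation.Binary.PropositionalEquality
open import Relation.Nullary using (¬_; Dec; does; yes; no; contradiction)
open import Relation.Nullary.Decidable using (decidable-stable)
import Data.Nat as ℕ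
import Data.Nat.DivMod as ℕ
import Data.Nat.Divisibility as ℕ
import Data.Nat.Properties as ℕ
import Data.Nat.Tactic.RingSolver as ℕ-Solver

-- Functions live on all subsets of the n-set at once, and the k-sets are cut out by the factor
-- `level k`. Every operator in play then factors over the points: it is either the tensor power of
-- a 2 × 2 matrix or the sum of the actions of such a matrix on single points. Commutation relations
-- of the Johnson scheme become identities between 2 × 2 matrices, settled entry by entry with
-- `refl`. All arithmetic stays in ℤ. Denominators are cancelled, or absorbed into a nonzero
-- multiple of the function that is decomposed. The adjacency operator is shifted by l = C(n-k-1,
-- k-1). This annihilates the part with j = 1 and leaves no negative eigenvalue, so in the case of
-- equality the shifted operator sends the indicator to a constant, whose value can be read off at
-- any k-set outside the family. The argument asks only whether a shifted eigenvalue vanishes, not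
-- for which j; so it covers n = 2k as well, where every odd j has the least eigenvalue -1 and stars
-- are far from being the only maximum families.

module ErdősKoRado where
  open import Data.Integer using (ℤ; +_; -[1+_]; _+_; _*_; _-_; -_; 0ℤ; 1ℤ; -1ℤ; _≤_; +≤+)
  open import Data.Integer.Properties
  open import Data.Integer.Tactic.RingSolver using (solve-∀)
  open import Data.Nat using (ℕ; zero; suc; s≤s; z≤n; _!)
  open ≡-Reasoning

  -- Tensor powers of 2 × 2 matrices and their derivations.

  Fn : ℕ → Set
  Fn n = Subset n → ℤ

  Matrix : Set
  Matrix = Bool → Bool → ℤ

  matrix : ℤ → ℤ → ℤ → ℤ → Matrix
  matrix a b c d true  true  = a
  matrix a b c d true  false = b
  matrix a b c d false true  = c
  matrix a b c d false false = d

  infixl 7 _·ᵐ_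
  _·ᵐ_ : Matrix → Matrix → Matrix
  (m ·ᵐ p) x z = m x true * p true z + m x false * p false z

  slice : ∀ {n} → Bool → Fn (suc n) → Fn n
  slice x f S = f (x ∷ S)

  -- The n-fold tensor power of m, with coordinate x of the row index S and
  -- coordinate y of the column index T contributing m x y.
  tens : ∀ {n} → Matrix → Fn n → Fn n
  tens m f []      = f []
  tens m f (x ∷ S) = m x true * tens m (slice true f) S + m x false * tens m (slice false f) S

  -- The sum over all coordinates of p acting on that coordinate alone.
  deriv : ∀ {n} → Matrix → Fn n → Fn n
  deriv p f []      = 0ℤ
  deriv p f (x ∷ S) =
    (p x true * f (true ∷ S) + p x false * f (false ∷ S)) + deriv p (slice x f) S

  tens-cong : ∀ {n} m {f g : Fn n} → f ≗ g → tens m f ≗ tens m g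
  tens-cong m e []      = e []
  tens-cong m e (x ∷ S) = cong₂ (λ a b → m x true * a + m x false * b)
    (tens-cong m (λ T → e (true ∷ T)) S) (tens-cong m (λ T → e (false ∷ T)) S)

  tens-linear : ∀ {n} m a b (f g : Fn n) →
                tens m (λ S → a * f S + b * g S) ≗ λ S → a * tens m f S + b * tens m g S
  tens-linear m a b f g []      = refl
  tens-linear m a b f g (x ∷ S) = trans
    (cong₂ (λ s t → m x true * s + m x false * t)
      (tens-linear m a b (slice true f) (slice true g) S)
      (tens-linear m a b (slice false f) (slice false g) S))
    (identity a b (m x true) (m x false) _ _ _ _)
    where
    identity : ∀ a b c d f₁ g₁ f₀ g₀ →
               c * (a * f₁ + b * g₁) + d * (a * f₀ + b * g₀) ≡
               a * (c * f₁ + d * f₀) + b * (c * g₁ + d * g₀)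
    identity = solve-∀

  deriv-linear : ∀ {n} p a b (f g : Fn n) →
                 deriv p (λ S → a * f S + b * g S) ≗ λ S → a * deriv p f S + b * deriv p g S
  deriv-linear p a b f g []      = identity a b
    where
    identity : ∀ a b → 0ℤ ≡ a * 0ℤ + b * 0ℤ
    identity = solve-∀
  deriv-linear p a b f g (x ∷ S) = trans
    (cong (λ s → (p x true * _ + p x false * _) + s) (deriv-linear p a b (slice x f) (slice x g) S))
    (identity a b (p x true) (p x false) _ _ _ _ _ _)
    where
    identity : ∀ a b c d f₁ g₁ f₀ g₀ s t →
               (c * (a * f₁ + b * g₁) + d * (a * f₀ + b * g₀)) + (a * s + b * t) ≡
               a * ((c * f₁ + d * f₀) + s) + b * ((c * g₁ + d * g₀) + t)
    identity = solve-∀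

  tens-add : ∀ {n} m (f g : Fn n) → tens m (λ S → f S + g S) ≗ λ S → tens m f S + tens m g S
  tens-add m f g S = trans
    (tens-cong m (λ T → units (f T) (g T)) S)
    (trans (tens-linear m 1ℤ 1ℤ f g S) (sym (units (tens m f S) (tens m g S))))
    where
    units : ∀ a b → a + b ≡ 1ℤ * a + 1ℤ * b
    units = solve-∀

  tens-scale : ∀ {n} m a (f : Fn n) → tens m (λ S → a * f S) ≗ λ S → a * tens m f S
  tens-scale m a f S = trans
    (tens-cong m (λ T → pad a (f T)) S)
    (trans (tens-linear m a 0ℤ f f S) (sym (pad a _)))
    where
    pad : ∀ a b → a * b ≡ a * b + 0ℤ * b
    pad = solve-∀

  tens-zero : ∀ {n} m {f : Fn n} → (∀ S → f S ≡ 0ℤ) → ∀ S → tens m f S ≡ 0ℤ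
  tens-zero m {f} e S = trans (tens-cong m (λ T → trans (e T) (sym (*-zeroˡ (f T)))) S)
    (trans (tens-scale m 0ℤ f S) (*-zeroˡ (tens m f S)))

  deriv-cong : ∀ {n} p {f g : Fn n} → f ≗ g → deriv p f ≗ deriv p g
  deriv-cong p e []      = refl
  deriv-cong p e (x ∷ S) = cong₂ _+_
    (cong₂ (λ s t → p x true * s + p x false * t) (e (true ∷ S)) (e (false ∷ S)))
    (deriv-cong p (λ T → e (x ∷ T)) S)

  deriv-plus : ∀ {n} p (f g : Fn n) → deriv p (λ S → f S + g S) ≗ λ S → deriv p f S + deriv p g S
  deriv-plus p f g S = trans
    (deriv-cong p (λ T → units (f T) (g T)) S)
    (trans (deriv-linear p 1ℤ 1ℤ f g S) (sym (units (deriv p f S) (deriv p g S))))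
    where
    units : ∀ a b → a + b ≡ 1ℤ * a + 1ℤ * b
    units = solve-∀

  deriv-scale : ∀ {n} p a (f : Fn n) → deriv p (λ S → a * f S) ≗ λ S → a * deriv p f S
  deriv-scale p a f S = trans
    (deriv-cong p (λ T → pad a (f T)) S)
    (trans (deriv-linear p a 0ℤ f f S) (sym (pad a (deriv p f S))))
    where
    pad : ∀ a b → a * b ≡ a * b + 0ℤ * b
    pad = solve-∀

  deriv-add : ∀ {n} p {q r} (f : Fn n) → (∀ x y → r x y ≡ p x y + q x y) →
              ∀ S → deriv r f S ≡ deriv p f S + deriv q f S
  deriv-add p f e []      = refl
  deriv-add p {q} {r} f e (x ∷ S) = trans
    (cong₂ _+_ (cong₂ (λ a b → a * f (true ∷ S) + b * f (false ∷ S)) (e x true) (e x false))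
               (deriv-add p (slice x f) e S))
    (identity (p x true) (p x false) (q x true) (q x false) _ _ _ _)
    where
    identity : ∀ a b c d f₁ f₀ s t →
               ((a + c) * f₁ + (b + d) * f₀) + (s + t) ≡
               ((a * f₁ + b * f₀) + s) + ((c * f₁ + d * f₀) + t)
    identity = solve-∀

  deriv-congᵐ : ∀ {n p q} → (∀ x y → p x y ≡ q x y) → (f : Fn n) → deriv p f ≗ deriv q f
  deriv-congᵐ e f []      = refl
  deriv-congᵐ e f (x ∷ S) = cong₂ _+_
    (cong₂ (λ a b → a * f (true ∷ S) + b * f (false ∷ S)) (e x true) (e x false))
    (deriv-congᵐ e (slice x f) S)

  -- Tensor powers are multiplicative. The product enters as a matrix `q` with entrywise equality
  -- because matrices are functions on `Bool`, which are compared pointwise.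
  tens-tens : ∀ {n} m p {q} → (∀ x y → (m ·ᵐ p) x y ≡ q x y) →
              (f : Fn n) → tens m (tens p f) ≗ tens q f
  tens-tens m p e f []      = refl
  tens-tens m p {q} e f (x ∷ S) = begin
    m x true * tens m (slice true (tens p f)) S + m x false * tens m (slice false (tens p f)) S
      ≡⟨ cong₂ (λ s t → m x true * s + m x false * t) (row true) (row false) ⟩
    m x true * (p true true * F true + p true false * F false) +
    m x false * (p false true * F true + p false false * F false)
      ≡⟨ identity (m x true) (m x false) (p true true) (p true false) (p false true) (p false false) _ _ ⟩
    (m ·ᵐ p) x true * F true + (m ·ᵐ p) x false * F false
      ≡⟨ cong₂ (λ a b → a * F true + b * F false) (e x true) (e x false) ⟩
    q x true * F true + q x false * F false ∎
    where
    F : Bool → ℤ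
    F y = tens q (slice y f) S
    row : ∀ y → tens m (slice y (tens p f)) S ≡ p y true * F true + p y false * F false
    row y = trans (tens-linear m (p y true) (p y false) _ _ S)
      (cong₂ (λ s t → p y true * s + p y false * t)
        (tens-tens m p e (slice true f) S) (tens-tens m p e (slice false f) S))
    identity : ∀ a b c d g h s t →
               a * (c * s + d * t) + b * (g * s + h * t) ≡ (a * c + b * g) * s + (a * d + b * h) * t
    identity = solve-∀

  -- Every commutation relation between the operators below is an instance of
  -- this, hence a 2 × 2 matrix identity.
  tens-deriv : ∀ {n} m p q → (∀ x y → (m ·ᵐ p) x y ≡ (q ·ᵐ m) x y) →
               (f : Fn n) → tens m (deriv p f) ≗ deriv q (tens m f)
  tens-deriv m p q e f []      = refl
  tens-deriv m p q e f (x ∷ S) = begin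
    m x true * tens m (slice true (deriv p f)) S + m x false * tens m (slice false (deriv p f)) S
      ≡⟨ cong₂ (λ s t → m x true * s + m x false * t) (row true) (row false) ⟩
    m x true * ((p true true * F true + p true false * F false) + G true) +
    m x false * ((p false true * F true + p false false * F false) + G false)
      -- The action on the head point collects into the product `m ·ᵐ p`, where the hypothesis
      -- applies; the actions on the other points have already been commuted by recursion.
      ≡⟨ identity₁ (m x true) (m x false) (p true true) (p true false) (p false true) (p false false) _ _ _ _ ⟩
    ((m ·ᵐ p) x true * F true + (m ·ᵐ p) x false * F false) + (m x true * G true + m x false * G false)
      ≡⟨ cong₂ (λ a b → (a * F true + b * F false) + (m x true * G true + m x false * G false)) (e x true) (e x false) ⟩
    ((q ·ᵐ m) x true * F true + (q ·ᵐ m) x false * F false) + (m x true * G true + m x false * G false)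
      ≡⟨ identity₂ (q x true) (q x false) (m true true) (m true false) (m false true) (m false false) _ _ _ ⟩
    (q x true * tens m f (true ∷ S) + q x false * tens m f (false ∷ S)) + (m x true * G true + m x false * G false)
      ≡⟨ cong (λ s → (q x true * tens m f (true ∷ S) + q x false * tens m f (false ∷ S)) + s)
              (deriv-linear q (m x true) (m x false) _ _ S) ⟨
    deriv q (tens m f) (x ∷ S) ∎
    where
    F G : Bool → ℤ
    F y = tens m (slice y f) S
    G y = deriv q (tens m (slice y f)) S
    row : ∀ y → tens m (slice y (deriv p f)) S ≡ (p y true * F true + p y false * F false) + G y
    row y = trans (tens-add m _ _ S)
      (cong₂ _+_ (tens-linear m (p y true) (p y false) _ _ S) (tens-deriv m p q e (slice y f) S))
    identity₁ : ∀ a b c d g h s t u v →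
                a * ((c * s + d * t) + u) + b * ((g * s + h * t) + v) ≡
                ((a * c + b * g) * s + (a * d + b * h) * t) + (a * u + b * v)
    identity₁ = solve-∀
    identity₂ : ∀ a b c d g h s t u →
                ((a * c + b * g) * s + (a * d + b * h) * t) + u ≡
                (a * (c * s + d * t) + b * (g * s + h * t)) + u
    identity₂ = solve-∀

  -- Finite sums, and sums over all subsets.

  sumBelow : ℕ → (ℕ → ℤ) → ℤ
  sumBelow zero    f = 0ℤ
  sumBelow (suc k) f = f k + sumBelow k f

  sumBelow-cong : ∀ k {f g} → (∀ j → j ℕ.< k → f j ≡ g j) → sumBelow k f ≡ sumBelow k g
  sumBelow-cong zero    e = refl
  sumBelow-cong (suc k) e = cong₂ _+_ (e k (ℕ.n<1+n k)) (sumBelow-cong k (λ j p → e j (ℕ.m<n⇒m<1+n p)))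

  sumBelow-scale : ∀ k a f → sumBelow k (λ j → a * f j) ≡ a * sumBelow k f
  sumBelow-scale zero    a f = sym (*-zeroʳ a)
  sumBelow-scale (suc k) a f = trans (cong (λ s → a * f k + s) (sumBelow-scale k a f))
    (sym (*-distribˡ-+ a (f k) (sumBelow k f)))

  deriv-sumBelow : ∀ {n} p k (F : ℕ → Fn n) →
                   deriv p (λ S → sumBelow k (λ j → F j S)) ≗ λ S → sumBelow k (λ j → deriv p (F j) S)
  deriv-sumBelow p zero    F S = deriv-zero p S
    where
    deriv-zero : ∀ {n} p (S : Subset n) → deriv p (λ _ → 0ℤ) S ≡ 0ℤ
    deriv-zero p []      = refl
    deriv-zero p (x ∷ S) = trans (cong (λ s → (p x true * 0ℤ + p x false * 0ℤ) + s) (deriv-zero p S))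
      (identity (p x true) (p x false))
      where
      identity : ∀ a b → (a * 0ℤ + b * 0ℤ) + 0ℤ ≡ 0ℤ
      identity = solve-∀
  deriv-sumBelow p (suc k) F S = trans
    (deriv-plus p (F k) (λ T → sumBelow k (λ j → F j T)) S)
    (cong (λ s → deriv p (F k) S + s) (deriv-sumBelow p k F S))

  tens-sumBelow : ∀ {n} m k (F : ℕ → Fn n) →
                  tens m (λ S → sumBelow k (λ j → F j S)) ≗ λ S → sumBelow k (λ j → tens m (F j) S)
  tens-sumBelow m zero    F S = tens-zero m (λ _ → refl) S
  tens-sumBelow m (suc k) F S = trans
    (tens-add m (F k) (λ T → sumBelow k (λ j → F j T)) S)
    (cong (λ s → tens m (F k) S + s) (tens-sumBelow m k F S))

  ∑ : ∀ {n} → Fn n → ℤ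
  ∑ {zero}  f = f []
  ∑ {suc n} f = ∑ (slice true f) + ∑ (slice false f)

  ∑-cong : ∀ {n} {f g : Fn n} → f ≗ g → ∑ f ≡ ∑ g
  ∑-cong {zero}  e = e []
  ∑-cong {suc n} e = cong₂ _+_ (∑-cong (λ S → e (true ∷ S))) (∑-cong (λ S → e (false ∷ S)))

  ∑-linear : ∀ {n} a b (f g : Fn n) → ∑ (λ S → a * f S + b * g S) ≡ a * ∑ f + b * ∑ g
  ∑-linear {zero}  a b f g = refl
  ∑-linear {suc n} a b f g = trans
    (cong₂ _+_ (∑-linear a b (slice true f) (slice true g)) (∑-linear a b (slice false f) (slice false g)))
    (identity a b _ _ _ _)
    where
    identity : ∀ a b s t u v → (a * s + b * t) + (a * u + b * v) ≡ a * (s + u) + b * (t + v)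
    identity = solve-∀

  ∑-scale : ∀ {n} a (f : Fn n) → ∑ (λ S → a * f S) ≡ a * ∑ f
  ∑-scale a f = trans (∑-cong (λ S → pad a (f S))) (trans (∑-linear a 0ℤ f f) (sym (pad a _)))
    where
    pad : ∀ a b → a * b ≡ a * b + 0ℤ * b
    pad = solve-∀

  ∑-add : ∀ {n} (f g : Fn n) → ∑ (λ S → f S + g S) ≡ ∑ f + ∑ g
  ∑-add f g = trans (∑-cong (λ S → units (f S) (g S))) (trans (∑-linear 1ℤ 1ℤ f g) (sym (units (∑ f) (∑ g))))
    where
    units : ∀ a b → a + b ≡ 1ℤ * a + 1ℤ * b
    units = solve-∀

  ∑-zero : ∀ {n} {f : Fn n} → (∀ S → f S ≡ 0ℤ) → ∑ f ≡ 0ℤ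
  ∑-zero {zero}  e = e []
  ∑-zero {suc n} e = cong₂ _+_ (∑-zero (λ S → e (true ∷ S))) (∑-zero (λ S → e (false ∷ S)))

  transpose : Matrix → Matrix
  transpose p x y = p y x

  -- The adjoint of an operator acting on one point at a time is the same operator for the
  -- transposed matrix. It makes `up` and `down` adjoint to each other.
  ∑-deriv : ∀ {n} p (f g : Fn n) → ∑ (λ S → f S * deriv p g S) ≡ ∑ (λ S → deriv (transpose p) f S * g S)
  ∑-deriv {zero}  p f g = trans (*-zeroʳ (f [])) (sym (*-zeroˡ (g [])))
  ∑-deriv {suc n} p f g = begin
    ∑ (λ S → f₁ S * ((p true true * g₁ S + p true false * g₀ S) + deriv p g₁ S)) +
    ∑ (λ S → f₀ S * ((p false true * g₁ S + p false false * g₀ S) + deriv p g₀ S))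
      ≡⟨ ∑-add {n} _ _ ⟨
    ∑ (λ S → f₁ S * ((p true true * g₁ S + p true false * g₀ S) + deriv p g₁ S) +
             f₀ S * ((p false true * g₁ S + p false false * g₀ S) + deriv p g₀ S))
      ≡⟨ ∑-cong (λ S → identity₁ (p true true) (p true false) (p false true) (p false false) (f₁ S) (f₀ S) (g₁ S) (g₀ S) _ _) ⟩
    ∑ (λ S → X S + (f₁ S * deriv p g₁ S + f₀ S * deriv p g₀ S))
      ≡⟨ trans (∑-add {n} _ _) (cong (λ s → ∑ X + s) (∑-add {n} _ _)) ⟩
    ∑ X + (∑ (λ S → f₁ S * deriv p g₁ S) + ∑ (λ S → f₀ S * deriv p g₀ S))
      ≡⟨ cong (λ s → ∑ X + s) (cong₂ _+_ (∑-deriv p f₁ g₁) (∑-deriv p f₀ g₀)) ⟩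
    ∑ X + (∑ (λ S → deriv pᵗ f₁ S * g₁ S) + ∑ (λ S → deriv pᵗ f₀ S * g₀ S))
      ≡⟨ trans (∑-add {n} _ _) (cong (λ s → ∑ X + s) (∑-add {n} _ _)) ⟨
    ∑ (λ S → X S + (deriv pᵗ f₁ S * g₁ S + deriv pᵗ f₀ S * g₀ S))
      ≡⟨ ∑-cong (λ S → identity₂ (p true true) (p true false) (p false true) (p false false) (f₁ S) (f₀ S) (g₁ S) (g₀ S) _ _) ⟩
    ∑ (λ S → ((p true true * f₁ S + p false true * f₀ S) + deriv pᵗ f₁ S) * g₁ S +
             ((p true false * f₁ S + p false false * f₀ S) + deriv pᵗ f₀ S) * g₀ S)
      ≡⟨ ∑-add {n} _ _ ⟩
    ∑ (λ S → ((p true true * f₁ S + p false true * f₀ S) + deriv pᵗ f₁ S) * g₁ S) +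
    ∑ (λ S → ((p true false * f₁ S + p false false * f₀ S) + deriv pᵗ f₀ S) * g₀ S) ∎
    where
    pᵗ : Matrix
    pᵗ = transpose p
    f₁ f₀ g₁ g₀ X : Fn n
    f₁ = slice true f
    f₀ = slice false f
    g₁ = slice true g
    g₀ = slice false g
    X S = f₁ S * (p true true * g₁ S + p true false * g₀ S) + f₀ S * (p false true * g₁ S + p false false * g₀ S)
    identity₁ : ∀ a b c d s t u v w z →
                s * ((a * u + b * v) + w) + t * ((c * u + d * v) + z) ≡
                (s * (a * u + b * v) + t * (c * u + d * v)) + (s * w + t * z)
    identity₁ = solve-∀
    identity₂ : ∀ a b c d s t u v w z →
                (s * (a * u + b * v) + t * (c * u + d * v)) + (w * u + z * v) ≡
                ((a * s + c * t) + w) * u + ((b * s + d * t) + z) * v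
    identity₂ = solve-∀

  -- The operators of the Boolean lattice.

  entrywise : ∀ {P : Bool → Bool → Set} → P true true → P true false → P false true → P false false →
              ∀ x y → P x y
  entrywise tt tf ft ff true  true  = tt
  entrywise tt tf ft ff true  false = tf
  entrywise tt tf ft ff false true  = ft
  entrywise tt tf ft ff false false = ff

  isolate-summand : ∀ {s j e u} → s * e ≡ j * e + u → u ≡ (s - j) * e
  isolate-summand {s} {j} {e} {u} h = trans (identity₁ j e u) (trans (cong (_- j * e) (sym h)) (identity₂ s j e))
    where
    identity₁ : ∀ j e u → u ≡ (j * e + u) - j * e
    identity₁ = solve-∀
    identity₂ : ∀ s j e → s * e - j * e ≡ (s - j) * e
    identity₂ = solve-∀

  -- Rows and columns are ordered inside, outside.  deriv nᵐ and deriv cᵐ multiply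
  -- by ∣ S ∣ and n − ∣ S ∣.
  uᵐ dᵐ nᵐ cᵐ n-dᵐ bᵐ eᵐ aᵐ sᵐ : Matrix
  uᵐ   = matrix 0ℤ 1ℤ 0ℤ 0ℤ
  dᵐ   = matrix 0ℤ 0ℤ 1ℤ 0ℤ
  nᵐ   = matrix 1ℤ 0ℤ 0ℤ 0ℤ
  cᵐ   = matrix 0ℤ 0ℤ 0ℤ 1ℤ
  n-dᵐ = matrix 1ℤ 0ℤ -1ℤ 0ℤ
  bᵐ   = matrix 1ℤ 1ℤ 0ℤ 1ℤ
  eᵐ   = matrix 1ℤ 0ℤ 1ℤ 1ℤ
  aᵐ   = matrix 0ℤ 1ℤ 1ℤ 1ℤ
  sᵐ   = matrix -1ℤ 0ℤ 0ℤ 1ℤ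

  -- The names follow the level on which the result lives: `up f S` sums f over S with one point
  -- removed, so it raises functions on the j-sets to the (j+1)-sets; `down f S` sums f over S with
  -- one point added.
  up down subsetSum supersetSum disjointSum : ∀ {n} → Fn n → Fn n
  up          = deriv uᵐ
  down        = deriv dᵐ
  subsetSum   = tens bᵐ
  supersetSum = tens eᵐ
  disjointSum = tens aᵐ

  deriv-step : ∀ {n} p (f : Fn (suc n)) x S {s} → deriv p (slice x f) S ≡ s →
               deriv p f (x ∷ S) ≡ (p x true * f (true ∷ S) + p x false * f (false ∷ S)) + s
  deriv-step p f x S e = cong (λ t → (p x true * f (true ∷ S) + p x false * f (false ∷ S)) + t) e

  deriv-nᵐ : ∀ {n} (f : Fn n) S → deriv nᵐ f S ≡ + ∣ S ∣ * f S
  deriv-nᵐ f []          = sym (*-zeroˡ (f []))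
  deriv-nᵐ f (true ∷ S)  = trans (deriv-step nᵐ f true S (deriv-nᵐ (slice true f) S))
    (identity (f (true ∷ S)) (f (false ∷ S)) (+ ∣ S ∣))
    where
    identity : ∀ a b m → (1ℤ * a + 0ℤ * b) + m * a ≡ (1ℤ + m) * a
    identity = solve-∀
  deriv-nᵐ f (false ∷ S) = trans (deriv-step nᵐ f false S (deriv-nᵐ (slice false f) S))
    (identity (f (true ∷ S)) (f (false ∷ S)) (+ ∣ S ∣))
    where
    identity : ∀ a b m → (0ℤ * a + 0ℤ * b) + m * b ≡ m * b
    identity = solve-∀

  deriv-cᵐ : ∀ {n} (f : Fn n) S → deriv cᵐ f S ≡ (+ n - + ∣ S ∣) * f S
  deriv-cᵐ f []          = sym (*-zeroˡ (f []))
  deriv-cᵐ {suc n} f (true ∷ S)  = trans (deriv-step cᵐ f true S (deriv-cᵐ (slice true f) S))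
    (identity (f (true ∷ S)) (f (false ∷ S)) (+ n) (+ ∣ S ∣))
    where
    identity : ∀ a b n m → (0ℤ * a + 0ℤ * b) + (n - m) * a ≡ ((1ℤ + n) - (1ℤ + m)) * a
    identity = solve-∀
  deriv-cᵐ {suc n} f (false ∷ S) = trans (deriv-step cᵐ f false S (deriv-cᵐ (slice false f) S))
    (identity (f (true ∷ S)) (f (false ∷ S)) (+ n) (+ ∣ S ∣))
    where
    identity : ∀ a b n m → (0ℤ * a + 1ℤ * b) + (n - m) * b ≡ ((1ℤ + n) - m) * b
    identity = solve-∀

  -- Every set that `up` reaches from S has one point fewer, so a weight depending on the size alone
  -- comes out of the sum. The weight is arbitrary because the recursion replaces it by `w ∘ suc` at
  -- an inside point; it is later taken to be `δ`.
  up-weight : ∀ {n} (w : ℕ → ℤ) (f : Fn n) S →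
              up (λ T → w (suc ∣ T ∣) * f T) S ≡ w ∣ S ∣ * up f S
  up-weight w f []          = sym (*-zeroʳ (w 0))
  up-weight w f (true ∷ S)  = trans
    (deriv-step uᵐ (λ T → w (suc ∣ T ∣) * f T) true S (up-weight (w ∘ suc) (slice true f) S))
    (identity (w (suc (suc ∣ S ∣))) (w (suc ∣ S ∣)) (f (true ∷ S)) (f (false ∷ S)) (up (slice true f) S))
    where
    identity : ∀ v w a b t → (0ℤ * (v * a) + 1ℤ * (w * b)) + w * t ≡ w * ((0ℤ * a + 1ℤ * b) + t)
    identity = solve-∀
  up-weight w f (false ∷ S) = trans
    (deriv-step uᵐ (λ T → w (suc ∣ T ∣) * f T) false S (up-weight w (slice false f) S))
    (identity (w (suc (suc ∣ S ∣))) (w (suc ∣ S ∣)) (w ∣ S ∣) (f (true ∷ S)) (f (false ∷ S)) (up (slice false f) S))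
    where
    identity : ∀ v w x a b t → (0ℤ * (v * a) + 0ℤ * (w * b)) + x * t ≡ x * ((0ℤ * a + 0ℤ * b) + t)
    identity = solve-∀

  down-weight : ∀ {n} (w : ℕ → ℤ) (f : Fn n) S →
                down (λ T → w ∣ T ∣ * f T) S ≡ w (suc ∣ S ∣) * down f S
  down-weight w f []          = sym (*-zeroʳ (w 1))
  down-weight w f (true ∷ S)  = trans
    (deriv-step dᵐ (λ T → w ∣ T ∣ * f T) true S (down-weight (w ∘ suc) (slice true f) S))
    (identity (w (suc ∣ S ∣)) (w ∣ S ∣) (w (suc (suc ∣ S ∣))) (f (true ∷ S)) (f (false ∷ S)) (down (slice true f) S))
    where
    identity : ∀ v w x a b t → (0ℤ * (v * a) + 0ℤ * (w * b)) + x * t ≡ x * ((0ℤ * a + 0ℤ * b) + t)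
    identity = solve-∀
  down-weight w f (false ∷ S) = trans
    (deriv-step dᵐ (λ T → w ∣ T ∣ * f T) false S (down-weight w (slice false f) S))
    (identity (w (suc ∣ S ∣)) (w ∣ S ∣) (f (true ∷ S)) (f (false ∷ S)) (down (slice false f) S))
    where
    identity : ∀ v w a b t → (1ℤ * (v * a) + 0ℤ * (w * b)) + v * t ≡ v * ((1ℤ * a + 0ℤ * b) + t)
    identity = solve-∀

  -- Makes an induction hypothesis usable under `down` when it is known only for the sets with one
  -- point more than S.
  down-local : ∀ {n} (f g : Fn n) S → (∀ T → ∣ T ∣ ≡ suc ∣ S ∣ → f T ≡ g T) → down f S ≡ down g S
  down-local f g []          e = refl
  down-local f g (true ∷ S)  e = cong₂ _+_
    (identity (f (true ∷ S)) (f (false ∷ S)) (g (true ∷ S)) (g (false ∷ S)))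
    (down-local (slice true f) (slice true g) S (λ T p → e (true ∷ T) (cong suc p)))
    where
    identity : ∀ a b c d → 0ℤ * a + 0ℤ * b ≡ 0ℤ * c + 0ℤ * d
    identity = solve-∀
  down-local f g (false ∷ S) e = cong₂ _+_
    (trans (cong (λ s → 1ℤ * s + 0ℤ * f (false ∷ S)) (e (true ∷ S) refl))
      (identity (g (true ∷ S)) (f (false ∷ S)) (g (false ∷ S))))
    (down-local (slice false f) (slice false g) S (λ T p → e (false ∷ T) p))
    where
    identity : ∀ a b c → 1ℤ * a + 0ℤ * b ≡ 1ℤ * a + 0ℤ * c
    identity = solve-∀

  -- The Kronecker delta, by recursion rather than by a test: `δ (suc k) (suc m)` reduces to
  -- `δ k m`, so the shift of levels in `up-weight` and `down-weight` holds by computation.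
  δ : ℕ → ℕ → ℤ
  δ zero    zero    = 1ℤ
  δ zero    (suc m) = 0ℤ
  δ (suc k) zero    = 0ℤ
  δ (suc k) (suc m) = δ k m

  δ-refl : ∀ k → δ k k ≡ 1ℤ
  δ-refl zero    = refl
  δ-refl (suc k) = δ-refl k

  δ-≢ : ∀ k m → m ≢ k → δ k m ≡ 0ℤ
  δ-≢ zero    zero    m≢k = contradiction refl m≢k
  δ-≢ zero    (suc m) m≢k = refl
  δ-≢ (suc k) zero    m≢k = refl
  δ-≢ (suc k) (suc m) m≢k = δ-≢ k m (m≢k ∘ cong suc)

  level : ∀ {n} → ℕ → Fn n → Fn n
  level k f S = δ k ∣ S ∣ * f S

  level-at : ∀ {n} k (f : Fn n) S → ∣ S ∣ ≡ k → level k f S ≡ f S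
  level-at k f S refl = trans (cong (_* f S) (δ-refl k)) (*-identityˡ (f S))

  level-off : ∀ {n} k (f : Fn n) S → ∣ S ∣ ≢ k → level k f S ≡ 0ℤ
  level-off k f S ne = trans (cong (_* f S) (δ-≢ k ∣ S ∣ ne)) (*-zeroˡ (f S))

  level-cong : ∀ {n} k {f g : Fn n} → (∀ S → ∣ S ∣ ≡ k → f S ≡ g S) → level k f ≗ level k g
  level-cong k {f} {g} e S with ∣ S ∣ ℕ.≟ k
  ... | yes p = trans (level-at k f S p) (trans (e S p) (sym (level-at k g S p)))
  ... | no ¬p = trans (level-off k f S ¬p) (sym (level-off k g S ¬p))

  SupportedOn : ∀ {n} → ℕ → Fn n → Set
  SupportedOn j f = ∀ S → ∣ S ∣ ≢ j → f S ≡ 0ℤ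

  supported-scale : ∀ {n} j a {f : Fn n} → SupportedOn j f → SupportedOn j (λ S → a * f S)
  supported-scale j a supp S ne = trans (cong (λ t → a * t) (supp S ne)) (*-zeroʳ a)

  size-supported : ∀ {n} j {f : Fn n} → SupportedOn j f → ∀ S → + ∣ S ∣ * f S ≡ + j * f S
  size-supported j {f} supp S with ∣ S ∣ ℕ.≟ j
  ... | yes p = cong (λ m → + m * f S) p
  ... | no ¬p = trans (cong (λ t → + ∣ S ∣ * t) (supp S ¬p))
    (trans (*-zeroʳ (+ ∣ S ∣)) (sym (trans (cong (λ t → + j * t) (supp S ¬p)) (*-zeroʳ (+ j)))))

  level-supported : ∀ {n} j {f : Fn n} → SupportedOn j f → level j f ≗ f
  level-supported j {f} supp S with ∣ S ∣ ℕ.≟ j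
  ... | yes p = level-at j f S p
  ... | no ¬p = trans (level-off j f S ¬p) (sym (supp S ¬p))

  sign : ℕ → ℤ
  sign zero    = 1ℤ
  sign (suc j) = - sign j

  tens-sᵐ : ∀ {n} (f : Fn n) S → tens sᵐ f S ≡ sign ∣ S ∣ * f S
  tens-sᵐ f []          = sym (*-identityˡ (f []))
  tens-sᵐ f (true ∷ S)  = trans
    (cong (λ s → -1ℤ * s + 0ℤ * tens sᵐ (slice false f) S) (tens-sᵐ (slice true f) S))
    (identity (sign ∣ S ∣) (f (true ∷ S)) (tens sᵐ (slice false f) S))
    where
    identity : ∀ s a t → -1ℤ * (s * a) + 0ℤ * t ≡ - s * a
    identity = solve-∀
  tens-sᵐ f (false ∷ S) = trans
    (cong (λ s → 0ℤ * tens sᵐ (slice true f) S + 1ℤ * s) (tens-sᵐ (slice false f) S))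
    (identity (sign ∣ S ∣) (f (false ∷ S)) (tens sᵐ (slice true f) S))
    where
    identity : ∀ s a t → 0ℤ * t + 1ℤ * (s * a) ≡ s * a
    identity = solve-∀

  subsetSum-minimal : ∀ {n} (f : Fn n) S → (∀ T → ∣ T ∣ ℕ.< ∣ S ∣ → f T ≡ 0ℤ) → subsetSum f S ≡ f S
  subsetSum-minimal f []          low = refl
  subsetSum-minimal f (true ∷ S)  low = trans
    (cong₂ (λ s t → 1ℤ * s + 1ℤ * t)
      (subsetSum-minimal (slice true f) S (λ T p → low (true ∷ T) (s≤s p)))
      (trans (subsetSum-minimal (slice false f) S (λ T p → low (false ∷ T) (ℕ.m<n⇒m<1+n p)))
        (low (false ∷ S) (ℕ.n<1+n _))))
    (identity (f (true ∷ S)))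
    where
    identity : ∀ a → 1ℤ * a + 1ℤ * 0ℤ ≡ a
    identity = solve-∀
  subsetSum-minimal f (false ∷ S) low = trans
    (cong (λ t → 0ℤ * subsetSum (slice true f) S + 1ℤ * t)
      (subsetSum-minimal (slice false f) S (λ T p → low (false ∷ T) p)))
    (identity (subsetSum (slice true f) S) (f (false ∷ S)))
    where
    identity : ∀ t a → 0ℤ * t + 1ℤ * a ≡ a
    identity = solve-∀

  supersetSum-maximal : ∀ {n} (f : Fn n) S → (∀ T → ∣ S ∣ ℕ.< ∣ T ∣ → f T ≡ 0ℤ) → supersetSum f S ≡ f S
  supersetSum-maximal f []          high = refl
  supersetSum-maximal f (true ∷ S)  high = trans
    (cong (λ t → 1ℤ * t + 0ℤ * supersetSum (slice false f) S)
      (supersetSum-maximal (slice true f) S (λ T p → high (true ∷ T) (s≤s p))))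
    (identity (supersetSum (slice false f) S) (f (true ∷ S)))
    where
    identity : ∀ t a → 1ℤ * a + 0ℤ * t ≡ a
    identity = solve-∀
  supersetSum-maximal f (false ∷ S) high = trans
    (cong₂ (λ s t → 1ℤ * s + 1ℤ * t)
      (trans (supersetSum-maximal (slice true f) S (λ T p → high (true ∷ T) (ℕ.m<n⇒m<1+n p)))
        (high (true ∷ S) (ℕ.n<1+n _)))
      (supersetSum-maximal (slice false f) S (λ T p → high (false ∷ T) p)))
    (identity (f (false ∷ S)))
    where
    identity : ∀ a → 1ℤ * 0ℤ + 1ℤ * a ≡ a
    identity = solve-∀

  -- Inclusion–exclusion.
  disjointSum-factor : ∀ {n} (f : Fn n) → disjointSum f ≗ subsetSum (tens sᵐ (supersetSum f))
  disjointSum-factor f S = sym (trans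
    (tens-cong bᵐ (tens-tens sᵐ eᵐ (λ _ _ → refl) f) S)
    (tens-tens bᵐ (sᵐ ·ᵐ eᵐ) product f S))
    where
    product : ∀ x y → (bᵐ ·ᵐ (sᵐ ·ᵐ eᵐ)) x y ≡ aᵐ x y
    product = entrywise refl refl refl refl

  -- A set T disjoint from S with a marked point i of T is the same thing as a set T - i disjoint
  -- from S + i, with i outside both S and T - i.
  disjointSum-up : ∀ {n} (f : Fn n) → disjointSum (up f) ≗ down (disjointSum f)
  disjointSum-up = tens-deriv aᵐ uᵐ dᵐ (entrywise refl refl refl refl)

  -- Harmonic functions and their extensions to all levels.

  record Harmonic (n j : ℕ) : Set where
    field
      fun       : Fn n
      supported : SupportedOn j fun
      closed    : ∀ S → down fun S ≡ 0ℤ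

    -- One harmonic function of degree j gives an eigenvector on every level at once. Keeping all
    -- levels together is what allows induction from one level to the next.
    extension : Fn n
    extension = subsetSum fun

    -- For a j-set T inside S, the points of S are the j points of T and the ∣S∣ - j points whose
    -- removal keeps T inside S. The matrix `pᵐ` accounts for the first kind, `uᵐ` for the second.
    extension-up : ∀ S → up extension S ≡ (+ ∣ S ∣ - + j) * extension S
    extension-up S = isolate-summand {+ ∣ S ∣} {+ j} {extension S} (begin
      + ∣ S ∣ * extension S                  ≡⟨ deriv-nᵐ extension S ⟨
      deriv nᵐ extension S                   ≡⟨ deriv-add pᵐ extension split S ⟩
      deriv pᵐ extension S + up extension S  ≡⟨ cong (_+ up extension S) (begin
        deriv pᵐ extension S                   ≡⟨ tens-deriv bᵐ nᵐ pᵐ commute fun S ⟨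
        subsetSum (deriv nᵐ fun) S
          ≡⟨ tens-cong bᵐ (λ T → trans (deriv-nᵐ fun T) (size-supported j supported T)) S ⟩
        subsetSum (λ T → + j * fun T) S        ≡⟨ tens-scale bᵐ (+ j) fun S ⟩
        + j * extension S                      ∎) ⟩
      + j * extension S + up extension S     ∎)
      where
      pᵐ : Matrix
      pᵐ = matrix 1ℤ -1ℤ 0ℤ 0ℤ
      split : ∀ x y → nᵐ x y ≡ pᵐ x y + uᵐ x y
      split = entrywise refl refl refl refl
      commute : ∀ x y → (bᵐ ·ᵐ nᵐ) x y ≡ (pᵐ ·ᵐ bᵐ) x y
      commute = entrywise refl refl refl refl

    private
      deriv-fun : ∀ S → deriv n-dᵐ fun S ≡ + j * fun S
      deriv-fun S = begin
        deriv n-dᵐ fun S               ≡⟨ +-identityʳ _ ⟨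
        deriv n-dᵐ fun S + 0ℤ          ≡⟨ cong (λ t → deriv n-dᵐ fun S + t) (closed S) ⟨
        deriv n-dᵐ fun S + down fun S  ≡⟨ deriv-add n-dᵐ fun split S ⟨
        deriv nᵐ fun S               ≡⟨ deriv-nᵐ fun S ⟩
        + ∣ S ∣ * fun S              ≡⟨ size-supported j supported S ⟩
        + j * fun S                  ∎
        where
        split : ∀ x y → nᵐ x y ≡ n-dᵐ x y + dᵐ x y
        split = entrywise refl refl refl refl

    -- Add a point i outside S. The j-sets T ⊆ S are counted n - ∣S∣ times. The new ones are T = U +
    -- i with U ⊆ S, and since `fun` sums to zero over all U + i, their values can be replaced by
    -- minus those with i in S, where each T ⊆ S arises j times.
    extension-down : ∀ S → down extension S ≡ (+ n - + ∣ S ∣ - + j) * extension S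
    extension-down S = isolate-summand {+ n - + ∣ S ∣} {+ j} {extension S} (begin
      (+ n - + ∣ S ∣) * extension S            ≡⟨ deriv-cᵐ extension S ⟨
      deriv cᵐ extension S                     ≡⟨ deriv-add pᵐ extension split S ⟩
      deriv pᵐ extension S + down extension S  ≡⟨ cong (_+ down extension S) (begin
        deriv pᵐ extension S            ≡⟨ tens-deriv bᵐ n-dᵐ pᵐ commute fun S ⟨
        subsetSum (deriv n-dᵐ fun) S  ≡⟨ tens-cong bᵐ deriv-fun S ⟩
        subsetSum (λ T → + j * fun T) S ≡⟨ tens-scale bᵐ (+ j) fun S ⟩
        + j * extension S               ∎) ⟩
      + j * extension S + down extension S     ∎)
      where
      pᵐ : Matrix
      pᵐ = matrix 0ℤ 0ℤ -1ℤ 1ℤ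
      split : ∀ x y → cᵐ x y ≡ pᵐ x y + dᵐ x y
      split = entrywise refl refl refl refl
      commute : ∀ x y → (bᵐ ·ᵐ n-dᵐ) x y ≡ (pᵐ ·ᵐ bᵐ) x y
      commute = entrywise refl refl refl refl

    extension-minimal : ∀ S → ∣ S ∣ ℕ.≤ j → extension S ≡ fun S
    extension-minimal S ∣S∣≤j = subsetSum-minimal fun S
      (λ T p → supported T (ℕ.<⇒≢ (ℕ.<-≤-trans p ∣S∣≤j)))

    extension-low : ∀ S → ∣ S ∣ ℕ.< j → extension S ≡ 0ℤ
    extension-low S ∣S∣<j = trans (extension-minimal S (ℕ.<⇒≤ ∣S∣<j)) (supported S (ℕ.<⇒≢ ∣S∣<j))

    level-extension : level j extension ≗ fun
    level-extension S with ∣ S ∣ ℕ.≟ j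
    ... | yes p = trans (level-at j extension S p) (extension-minimal S (ℕ.≤-reflexive p))
    ... | no ¬p = trans (level-off j extension S ¬p) (sym (supported S ¬p))

    -- The sum over the supersets of a set S with fewer than j points vanishes: conjugation by `eᵐ`
    -- turns `n-dᵐ`, which acts on `fun` as j, into `nᵐ`, which acts as ∣S∣, so the sum is
    -- multiplied equally by two different numbers. From size j on, the only superset in the support
    -- can be S itself.
    supersetSum-fun : supersetSum fun ≗ fun
    supersetSum-fun S with ∣ S ∣ ℕ.<? j
    ... | no  p = supersetSum-maximal fun S (λ T q → supported T (ℕ.>⇒≢ (ℕ.≤-<-trans (ℕ.≮⇒≥ p) q)))
    ... | yes p = trans vanishes (sym (supported S (ℕ.<⇒≢ p)))
      where
      commute : ∀ x y → (eᵐ ·ᵐ n-dᵐ) x y ≡ (nᵐ ·ᵐ eᵐ) x y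
      commute = entrywise refl refl refl refl
      sizes : + ∣ S ∣ * supersetSum fun S ≡ + j * supersetSum fun S
      sizes = begin
        + ∣ S ∣ * supersetSum fun S                     ≡⟨ deriv-nᵐ (supersetSum fun) S ⟨
        deriv nᵐ (supersetSum fun) S                    ≡⟨ tens-deriv eᵐ _ nᵐ commute fun S ⟨
        supersetSum (deriv n-dᵐ fun) S ≡⟨ tens-cong eᵐ deriv-fun S ⟩
        supersetSum (λ T → + j * fun T) S               ≡⟨ tens-scale eᵐ (+ j) fun S ⟩
        + j * supersetSum fun S                         ∎
      difference : (+ ∣ S ∣ - + j) * supersetSum fun S ≡ 0ℤ
      difference = trans (*-distribʳ-- (supersetSum fun S) (+ ∣ S ∣) (+ j)) (i≡j⇒i-j≡0 sizes)
        where
        *-distribʳ-- : ∀ e s j → (s - j) * e ≡ s * e - j * e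
        *-distribʳ-- = solve-∀
      vanishes : supersetSum fun S ≡ 0ℤ
      vanishes with i*j≡0⇒i≡0∨j≡0 (+ ∣ S ∣ - + j) difference
      ... | inj₁ e = contradiction (+-injective (i-j≡0⇒i≡j _ _ e)) (ℕ.<⇒≢ p)
      ... | inj₂ e = e

    -- By inclusion and exclusion this is the sum over U ⊆ S of (-1)^∣U∣ times the sum of `fun` over
    -- the supersets of U, and the inner sum is `fun U`. Hence only one sign occurs.
    disjointSum-fun : ∀ S → disjointSum fun S ≡ sign j * extension S
    disjointSum-fun S = begin
      disjointSum fun S                          ≡⟨ disjointSum-factor fun S ⟩
      subsetSum (tens sᵐ (supersetSum fun)) S    ≡⟨ tens-cong bᵐ (tens-cong sᵐ supersetSum-fun) S ⟩
      subsetSum (tens sᵐ fun) S                  ≡⟨ tens-cong bᵐ (λ T → trans (tens-sᵐ fun T) (signs T)) S ⟩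
      subsetSum (λ T → sign j * fun T) S         ≡⟨ tens-scale bᵐ (sign j) fun S ⟩
      sign j * extension S                       ∎
      where
      signs : ∀ T → sign ∣ T ∣ * fun T ≡ sign j * fun T
      signs T with ∣ T ∣ ℕ.≟ j
      ... | yes q = cong (λ m → sign m * fun T) q
      ... | no ¬q = trans (cong (λ t → sign ∣ T ∣ * t) (supported T ¬q))
        (trans (*-zeroʳ (sign ∣ T ∣))
          (sym (trans (cong (λ t → sign j * t) (supported T ¬q)) (*-zeroʳ (sign j)))))

  open Harmonic

  -- Eigenvalues of the disjointness operator.

  nC0≡1 : ∀ n → n C 0 ≡ 1
  nC0≡1 n = trans (nCk≡nC[n∸k] {0} {n} z≤n) (nCn≡1 n)

  absorption : ∀ m i → suc i ℕ.* (suc m C suc i) ≡ suc m ℕ.* (m C i)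
  absorption m       zero    = trans (ℕ.+-identityʳ _) (trans (sym (nCk+nC[k+1]≡[n+1]C[k+1] m 0))
    (trans (cong (ℕ._+ (m C 1)) (nC0≡1 m)) (trans (cong suc (nC1≡n m))
      (sym (trans (cong (suc m ℕ.*_) (nC0≡1 m)) (ℕ.*-identityʳ (suc m)))))))
  absorption zero    (suc i) = trans (cong (suc (suc i) ℕ.*_) (k>n⇒nCk≡0 {1} {suc (suc i)} (s≤s (s≤s z≤n))))
    (trans (ℕ.*-zeroʳ (suc (suc i))) (sym (trans (ℕ.+-identityʳ _) (k>n⇒nCk≡0 {0} {suc i} (s≤s z≤n)))))
  absorption (suc m) (suc i) = begin
    suc (suc i) ℕ.* (suc (suc m) C suc (suc i))
      ≡⟨ cong (suc (suc i) ℕ.*_) (nCk+nC[k+1]≡[n+1]C[k+1] (suc m) (suc i)) ⟨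
    suc (suc i) ℕ.* (suc m C suc i ℕ.+ suc m C suc (suc i))
      ≡⟨ identity₁ i (suc m C suc i) (suc m C suc (suc i)) ⟩
    suc m C suc i ℕ.+ (suc i ℕ.* (suc m C suc i) ℕ.+ suc (suc i) ℕ.* (suc m C suc (suc i)))
      ≡⟨ cong (suc m C suc i ℕ.+_) (cong₂ ℕ._+_ (absorption m i) (absorption m (suc i))) ⟩
    suc m C suc i ℕ.+ (suc m ℕ.* (m C i) ℕ.+ suc m ℕ.* (m C suc i))
      ≡⟨ cong (suc m C suc i ℕ.+_) (ℕ.*-distribˡ-+ (suc m) (m C i) (m C suc i)) ⟨
    suc m C suc i ℕ.+ suc m ℕ.* (m C i ℕ.+ m C suc i)
      ≡⟨ cong (λ t → suc m C suc i ℕ.+ suc m ℕ.* t) (nCk+nC[k+1]≡[n+1]C[k+1] m i) ⟩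
    suc (suc m) ℕ.* (suc m C suc i) ∎
    where
    identity₁ : ∀ i a b → suc (suc i) ℕ.* (a ℕ.+ b) ≡ a ℕ.+ (suc i ℕ.* a ℕ.+ suc (suc i) ℕ.* b)
    identity₁ = ℕ-Solver.solve-∀

  -- Induction on i: (i + 1) level (i + 1 + j) φ is up (level (i + j) φ), and
  -- disjointSum turns up into down.
  disjointSum-extension : ∀ {n j} (H : Harmonic n j) i m S → ∣ S ∣ ℕ.+ j ℕ.+ m ≡ n → i ℕ.≤ m →
                          disjointSum (level (i ℕ.+ j) (extension H)) S ≡ + (m C i) * (sign j * extension H S)
  disjointSum-extension {j = j} H zero    m       S e i≤m = begin
    disjointSum (level j (extension H)) S        ≡⟨ tens-cong aᵐ (level-extension H) S ⟩
    disjointSum (fun H) S                        ≡⟨ disjointSum-fun H S ⟩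
    sign j * extension H S                       ≡⟨ *-identityˡ (sign j * extension H S) ⟨
    1ℤ * (sign j * extension H S)                ≡⟨ cong (λ c → + c * (sign j * extension H S)) (nC0≡1 m) ⟨
    + (m C 0) * (sign j * extension H S)         ∎
  disjointSum-extension {n} {j} H (suc i) (suc m) S e (s≤s i≤m) =
    *-cancelˡ-≡ (+ suc i) _ _ (begin
      + suc i * disjointSum (level (suc i ℕ.+ j) φ) S
        ≡⟨ tens-scale aᵐ (+ suc i) (level (suc i ℕ.+ j) φ) S ⟨
      disjointSum (λ T → + suc i * level (suc i ℕ.+ j) φ T) S
        ≡⟨ tens-cong aᵐ raise S ⟩
      disjointSum (up (level (i ℕ.+ j) φ)) S
        ≡⟨ disjointSum-up (level (i ℕ.+ j) φ) S ⟩
      down (disjointSum (level (i ℕ.+ j) φ)) S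
        -- The sets T seen here have one point more than S while m drops by one, so the size
        -- equation persists for the induction hypothesis.
        ≡⟨ down-local _ (λ T → + (m C i) * (sign j * φ T)) S
             (λ T p → disjointSum-extension H i m T 
               (trans (cong (λ s → s ℕ.+ j ℕ.+ m) p) (trans (sym (ℕ.+-suc (∣ S ∣ ℕ.+ j) m)) e)) i≤m) ⟩
      down (λ T → + (m C i) * (sign j * φ T)) S
        ≡⟨ trans (deriv-scale dᵐ (+ (m C i)) (λ T → sign j * φ T) S) (cong (λ t → + (m C i) * t) (deriv-scale dᵐ (sign j) φ S)) ⟩
      + (m C i) * (sign j * down φ S)
        ≡⟨ cong (λ t → + (m C i) * (sign j * t)) (trans (extension-down H S) (cong (_* φ S) codegree)) ⟩
      + (m C i) * (sign j * (+ suc m * φ S))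
        ≡⟨ identity₁ (+ (m C i)) (sign j) (+ suc m) (φ S) ⟩
      (+ suc m * + (m C i)) * (sign j * φ S)
        ≡⟨ cong (_* (sign j * φ S)) absorb ⟩
      (+ suc i * + (suc m C suc i)) * (sign j * φ S)
        ≡⟨ *-assoc (+ suc i) (+ (suc m C suc i)) (sign j * φ S) ⟩
      + suc i * (+ (suc m C suc i) * (sign j * φ S)) ∎)
    where
    φ : Fn n
    φ = extension H
    identity₁ : ∀ c s m f → c * (s * (m * f)) ≡ (m * c) * (s * f)
    identity₁ = solve-∀
    absorb : + suc m * + (m C i) ≡ + suc i * + (suc m C suc i)
    absorb = trans (sym (pos-* (suc m) (m C i))) (trans (cong +_ (sym (absorption m i))) (pos-* (suc i) (suc m C suc i)))
    codegree : + n - + ∣ S ∣ - + j ≡ + suc m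
    codegree = trans (cong (λ t → + t - + ∣ S ∣ - + j) (sym e)) (identity₂ (+ ∣ S ∣) (+ j) (+ suc m))
      where
      identity₂ : ∀ s j m → ((s + j) + m) - s - j ≡ m
      identity₂ = solve-∀
    raise : ∀ T → + suc i * level (suc i ℕ.+ j) φ T ≡ up (level (i ℕ.+ j) φ) T
    raise T = begin
      + suc i * level (suc i ℕ.+ j) φ T              ≡⟨ identity₃ (+ suc i) (δ (suc i ℕ.+ j) ∣ T ∣) (φ T) ⟩
      level (suc i ℕ.+ j) (λ T → + suc i * φ T) T    ≡⟨ level-cong (suc i ℕ.+ j) (λ T p → sym
        (trans (extension-up H T) (cong (_* φ T) (trans (cong (λ t → + t - + j) p) (identity₄ (+ suc i) (+ j)))))) T ⟩
      level (suc i ℕ.+ j) (up φ) T                   ≡⟨ up-weight (δ (suc i ℕ.+ j)) φ T ⟨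
      up (level (i ℕ.+ j) φ) T                       ∎
      where
      identity₃ : ∀ a b c → a * (b * c) ≡ b * (a * c)
      identity₃ = solve-∀
      identity₄ : ∀ i j → (i + j) - j ≡ i
      identity₄ = solve-∀

  -- Inner products on a level and orthogonality of the extensions.

  inner : ∀ {n} → ℕ → Fn n → Fn n → ℤ
  inner k f g = ∑ (level k (λ S → f S * g S))

  inner-cong : ∀ {n} k {f f′ g g′ : Fn n} → (∀ S → ∣ S ∣ ≡ k → f S ≡ f′ S) → (∀ S → ∣ S ∣ ≡ k → g S ≡ g′ S) →
               inner k f g ≡ inner k f′ g′
  inner-cong k p q = ∑-cong (level-cong k (λ S e → cong₂ _*_ (p S e) (q S e)))

  inner-scaleʳ : ∀ {n} k a (f g : Fn n) → inner k f (λ S → a * g S) ≡ a * inner k f g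
  inner-scaleʳ {n} k a f g = trans (∑-cong (λ S → identity (δ k ∣ S ∣) (f S) a (g S))) (∑-scale {n} a _)
    where
    identity : ∀ d f a g → d * (f * (a * g)) ≡ a * (d * (f * g))
    identity = solve-∀

  inner-comm : ∀ {n} k (f g : Fn n) → inner k f g ≡ inner k g f
  inner-comm k f g = ∑-cong (λ S → cong (λ t → δ k ∣ S ∣ * t) (*-comm (f S) (g S)))

  inner-plusʳ : ∀ {n} k (f g h : Fn n) → inner k f (λ S → g S + h S) ≡ inner k f g + inner k f h
  inner-plusʳ {n} k f g h = trans (∑-cong (λ S → identity (δ k ∣ S ∣) (f S) (g S) (h S))) (∑-add {n} _ _)
    where
    identity : ∀ d f g h → d * (f * (g + h)) ≡ d * (f * g) + d * (f * h)
    identity = solve-∀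

  inner-up : ∀ {n} k (f g : Fn n) → inner (suc k) f (up g) ≡ inner k (down f) g
  inner-up {n} k f g = begin
    inner (suc k) f (up g)
      ≡⟨ ∑-cong (λ S → identity (δ (suc k) ∣ S ∣) (f S) (up g S)) ⟩
    ∑ (λ S → f S * level (suc k) (up g) S)
      ≡⟨ ∑-cong (λ S → cong (λ t → f S * t) (up-weight (δ (suc k)) g S)) ⟨
    ∑ (λ S → f S * up (level k g) S)                  ≡⟨ ∑-deriv uᵐ f (level k g) ⟩
    ∑ (λ S → deriv (transpose uᵐ) f S * level k g S)  ≡⟨ ∑-cong (λ S → cong (_* level k g S)
        (deriv-congᵐ {p = transpose uᵐ} {dᵐ} (entrywise refl refl refl refl) f S)) ⟩
    ∑ (λ S → down f S * level k g S)                  ≡⟨ ∑-cong (λ S → identity (δ k ∣ S ∣) (down f S) (g S)) ⟨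
    inner k (down f) g                                ∎
    where
    identity : ∀ d f g → d * (f * g) ≡ f * (d * g)
    identity = solve-∀

  -- Adjointness of up and down relates the inner products on two consecutive
  -- levels by the factors k + 1 − i ≠ 0 and n − k − j.
  orthogonal-< : ∀ {n i j} (H : Harmonic n i) (K : Harmonic n j) → i ℕ.< j →
                 ∀ k → inner k (extension K) (extension H) ≡ 0ℤ
  orthogonal-< {j = j} H K i<j k with k ℕ.<? j
  -- The descent in k ends below level j, where `extension K` is zero because no j-set fits into a
  -- k-set.
  ... | yes k<j = ∑-zero (λ S → trans
    (level-cong k {g = λ _ → 0ℤ} (λ T e →
      trans (cong (_* extension H T) (extension-low K T (subst (ℕ._< j) (sym e) k<j))) (*-zeroˡ (extension H T))) S)
    (*-zeroʳ (δ k ∣ S ∣)))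
  orthogonal-< H K i<j zero | no k≮j = contradiction (ℕ.≤-<-trans z≤n i<j) k≮j
  orthogonal-< {n} {i} {j} H K i<j (suc k) | no k≮j =
    [ (λ e → contradiction (+-injective (i-j≡0⇒i≡j (+ suc k) (+ i) e)) (ℕ.>⇒≢ (ℕ.<-≤-trans i<j (ℕ.≮⇒≥ k≮j))))
    , (λ e → e) ]′
    (i*j≡0⇒i≡0∨j≡0 (+ suc k - + i) (begin
      (+ suc k - + i) * inner (suc k) ψ φ        ≡⟨ inner-scaleʳ (suc k) (+ suc k - + i) ψ φ ⟨
      inner (suc k) ψ (λ S → (+ suc k - + i) * φ S)
        ≡⟨ inner-cong (suc k) {f = ψ} (λ _ _ → refl) (λ S e → trans (extension-up H S) (cong (λ t → (+ t - + i) * φ S) e)) ⟨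
      inner (suc k) ψ (up φ)                     ≡⟨ inner-up k ψ φ ⟩
      inner k (down ψ) φ
        ≡⟨ inner-cong k {g = φ} (λ S e → trans (extension-down K S) (cong (λ t → (+ n - + t - + j) * ψ S) e)) (λ _ _ → refl) ⟩
      inner k (λ S → (+ n - + k - + j) * ψ S) φ  ≡⟨ inner-comm k (λ S → (+ n - + k - + j) * ψ S) φ ⟩
      inner k φ (λ S → (+ n - + k - + j) * ψ S)  ≡⟨ inner-scaleʳ k (+ n - + k - + j) φ ψ ⟩
      (+ n - + k - + j) * inner k φ ψ
        ≡⟨ cong (λ t → (+ n - + k - + j) * t) (trans (inner-comm k φ ψ) (orthogonal-< H K i<j k)) ⟩
      (+ n - + k - + j) * 0ℤ                     ≡⟨ *-zeroʳ (+ n - + k - + j) ⟩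
      0ℤ                                         ∎))
    where
    φ ψ : Fn n
    φ = extension H
    ψ = extension K

  orthogonal : ∀ {n i j} (H : Harmonic n i) (K : Harmonic n j) → i ≢ j →
               ∀ k → inner k (extension H) (extension K) ≡ 0ℤ
  orthogonal {i = i} {j} H K i≢j k with ℕ.<-cmp i j
  ... | tri< i<j _ _ = trans (inner-comm k (extension H) (extension K)) (orthogonal-< H K i<j k)
  ... | tri≈ _ i≡j _ = contradiction i≡j i≢j
  ... | tri> _ _ j<i = orthogonal-< K H j<i k

  -- Decomposition into extensions of harmonic functions.

  scaleᴴ : ∀ {n j} → ℤ → Harmonic n j → Harmonic n j
  scaleᴴ a H = record
    { fun       = λ S → a * fun H S
    ; supported = supported-scale _ a (supported H)
    ; closed    = λ S → trans (deriv-scale dᵐ a (fun H) S) (trans (cong (λ t → a * t) (closed H S)) (*-zeroʳ a))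
    }

  levelᴴ : ∀ {n} j (f : Fn n) → (∀ S → suc ∣ S ∣ ≡ j → down f S ≡ 0ℤ) → Harmonic n j
  levelᴴ j f closed = record
    { fun       = level j f
    ; supported = level-off j f
    ; closed    = λ S → trans (down-weight (δ j) f S) (vanishes S)
    }
    where
    vanishes : ∀ S → δ j (suc ∣ S ∣) * down f S ≡ 0ℤ
    vanishes S with suc ∣ S ∣ ℕ.≟ j
    ... | yes p = trans (cong (λ t → δ j (suc ∣ S ∣) * t) (closed S p)) (*-zeroʳ (δ j (suc ∣ S ∣)))
    ... | no ¬p = trans (cong (_* down f S) (δ-≢ j (suc ∣ S ∣) ¬p)) (*-zeroˡ (down f S))

  extend : ∀ {P : ℕ → Set} k → P k → (∀ j → P j) → ∀ j → P j
  extend k x g j with j ℕ.≟ k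
  ... | yes refl = x
  ... | no  _    = g j

  extend-at : ∀ {P : ℕ → Set} k (x : P k) (g : ∀ j → P j) → extend k x g k ≡ x
  extend-at k x g rewrite ℕ.≟-diag {k} refl = refl

  extend-≢ : ∀ {P : ℕ → Set} k (x : P k) (g : ∀ j → P j) {j} → j ≢ k → extend k x g j ≡ g j
  extend-≢ k x g {j} j≢k with j ℕ.≟ k
  ... | yes j≡k = contradiction j≡k j≢k
  ... | no  _   = refl

  -- A nonzero multiple of f is decomposed because the components themselves may have fractional
  -- values; all later identities are homogeneous in `scale`.
  record Decomposition {n} (k : ℕ) (f : Fn n) : Set where
    field
      scale     : ℤ
      scale≢0   : scale ≢ 0ℤ
      component : ∀ j → Harmonic n j
      total     : ∀ S → ∣ S ∣ ≡ k → scale * f S ≡ sumBelow (suc k) (λ j → extension (component j) S)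

  *-≢0 : ∀ a b → a ≢ 0ℤ → b ≢ 0ℤ → a * b ≢ 0ℤ
  *-≢0 a b a≢0 b≢0 ab≡0 = [ a≢0 , b≢0 ]′ (i*j≡0⇒i≡0∨j≡0 a ab≡0)

  -- down multiplies the j-th component of f on level k + 1 by n − k − j ≠ 0, so the
  -- components of down f on level k determine those of f up to a function killed by
  -- down; n ! clears the denominators.
  decompose : ∀ {n} k → k ℕ.+ k ℕ.≤ n → (f : Fn n) → Decomposition k f
  decompose zero    _    f = record
    { scale     = 1ℤ
    ; scale≢0   = λ ()
    ; component = component
    ; total     = λ S e → trans (*-identityˡ (f S)) (trans (sym (level-at 0 f S e))
        (trans (sym (extension-minimal (component 0) S (ℕ.≤-reflexive e))) (sym (+-identityʳ _))))
    }
    where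
    component : ∀ j → Harmonic _ j
    component zero    = levelᴴ 0 f (λ S ())
    component (suc j) = levelᴴ (suc j) (λ _ → 0ℤ) (λ S _ → deriv-sumBelow dᵐ 0 (λ _ _ → 0ℤ) S)
  decompose {n} (suc k) 2k≤n f = record
    { scale     = + (n !) * c
    ; scale≢0   = *-≢0 (+ (n !)) c (λ e → contradiction (+-injective e) (ℕ.≢-nonZero⁻¹ (n !) {{n ℕ.!≢0}})) c≢0
    ; component = extend (suc k) top scaled
    ; total     = λ S e → begin
        + (n !) * c * f S
          ≡⟨ identity₁ (+ (n !) * c * f S) (lower S) ⟩
        remainder S + lower S
          ≡⟨ cong₂ _+_
               (trans (sym (level-at (suc k) remainder S e)) (trans (sym (extension-minimal top S (ℕ.≤-reflexive e)))
                 (cong (λ H → extension H S) (sym (extend-at (suc k) top scaled)))))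
               (sumBelow-cong (suc k) (λ j j<k → cong (λ H → extension H S) (sym (extend-≢ (suc k) top scaled (ℕ.<⇒≢ j<k))))) ⟩
        sumBelow (suc (suc k)) (λ j → extension (extend (suc k) top scaled j) S) ∎
    }
    where
    k+k≤n : k ℕ.+ k ℕ.≤ n
    k+k≤n = ℕ.≤-trans (ℕ.+-mono-≤ (ℕ.n≤1+n k) (ℕ.n≤1+n k)) 2k≤n
    open Decomposition (decompose k k+k≤n (down f))
      renaming (scale to c; scale≢0 to c≢0; component to part; total to part-total)
    -- The factor n - k - j is written as a successor, so that it is visibly nonzero; being at most
    -- n it divides n !, and `r j` is the quotient by which the component of `down f` is multiplied.
    e-1 : ℕ → ℕ
    e-1 j = n ℕ.∸ suc (k ℕ.+ j)
    r : ℕ → ℤ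
    r j = + (n ! ℕ./ suc (e-1 j))
    r-spec : ∀ j → j ℕ.< suc k → r j * (+ n - + k - + j) ≡ + (n !)
    r-spec j (s≤s j≤k) = begin
      r j * (+ n - + k - + j)               ≡⟨ cong (λ t → r j * (+ t - + k - + j)) n≡ ⟩
      r j * (+ (suc (k ℕ.+ j) ℕ.+ e-1 j) - + k - + j)  ≡⟨ identity₂ (r j) (+ k) (+ j) (+ e-1 j) ⟩
      r j * + suc (e-1 j)                   ≡⟨ pos-* (n ! ℕ./ suc (e-1 j)) (suc (e-1 j)) ⟨
      + (n ! ℕ./ suc (e-1 j) ℕ.* suc (e-1 j))
        ≡⟨ cong +_ (ℕ.m/n*n≡m (ℕ.∣-trans (ℕ.m∣m*n (e-1 j !)) (ℕ.m≤n⇒m!∣n! e≤n))) ⟩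
      + (n !)                               ∎
      where
      k+j<n : suc (k ℕ.+ j) ℕ.≤ n
      k+j<n = ℕ.≤-trans (s≤s (ℕ.+-monoʳ-≤ k (ℕ.≤-trans j≤k (ℕ.n≤1+n k)))) 2k≤n
      n≡ : n ≡ suc (k ℕ.+ j) ℕ.+ e-1 j
      n≡ = sym (ℕ.m+[n∸m]≡n k+j<n)
      e≤n : suc (e-1 j) ℕ.≤ n
      e≤n = ℕ.≤-trans (s≤s (ℕ.m≤n+m (e-1 j) (k ℕ.+ j))) (ℕ.≤-reflexive (sym n≡))
      identity₂ : ∀ r k j e → r * (((1ℤ + (k + j)) + e) - k - j) ≡ r * (1ℤ + e)
      identity₂ = solve-∀
    scaled : ∀ j → Harmonic n j
    scaled j = scaleᴴ (r j) (part j)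
    -- On level k the functions `lower` and n ! c f have the same image under `down`. Their
    -- difference is therefore harmonic of degree k + 1 and supplies the top component.
    lower remainder : Fn n
    lower S = sumBelow (suc k) (λ j → extension (scaled j) S)
    remainder S = + (n !) * c * f S + - 1ℤ * lower S
    identity₁ : ∀ a b → a ≡ (a + - 1ℤ * b) + b
    identity₁ = solve-∀
    down-lower : ∀ S → ∣ S ∣ ≡ k → down lower S ≡ + (n !) * (c * down f S)
    down-lower S e = begin
      down lower S
        ≡⟨ deriv-sumBelow dᵐ (suc k) (λ j → extension (scaled j)) S ⟩
      sumBelow (suc k) (λ j → down (extension (scaled j)) S)   ≡⟨ sumBelow-cong (suc k) term ⟩
      sumBelow (suc k) (λ j → + (n !) * extension (part j) S)
        ≡⟨ sumBelow-scale (suc k) (+ (n !)) (λ j → extension (part j) S) ⟩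
      + (n !) * sumBelow (suc k) (λ j → extension (part j) S)  ≡⟨ cong (λ t → + (n !) * t) (part-total S e) ⟨
      + (n !) * (c * down f S)                                 ∎
      where
      term : ∀ j → j ℕ.< suc k → down (extension (scaled j)) S ≡ + (n !) * extension (part j) S
      term j j<k = begin
        down (extension (scaled j)) S                    ≡⟨ extension-down (scaled j) S ⟩
        (+ n - + ∣ S ∣ - + j) * extension (scaled j) S
          ≡⟨ cong₂ (λ s t → (+ n - + s - + j) * t) e (tens-scale bᵐ (r j) (fun (part j)) S) ⟩
        (+ n - + k - + j) * (r j * extension (part j) S)
          ≡⟨ identity₃ (+ n - + k - + j) (r j) (extension (part j) S) ⟩
        (r j * (+ n - + k - + j)) * extension (part j) S ≡⟨ cong (_* extension (part j) S) (r-spec j j<k) ⟩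
        + (n !) * extension (part j) S                   ∎
        where
        identity₃ : ∀ a b c → a * (b * c) ≡ (b * a) * c
        identity₃ = solve-∀
    top : Harmonic n (suc k)
    top = levelᴴ (suc k) remainder λ S e → begin
      down remainder S
        ≡⟨ deriv-linear dᵐ (+ (n !) * c) (- 1ℤ) f lower S ⟩
      + (n !) * c * down f S + - 1ℤ * down lower S
        ≡⟨ cong (λ t → + (n !) * c * down f S + - 1ℤ * t) (down-lower S (ℕ.suc-injective e)) ⟩
      + (n !) * c * down f S + - 1ℤ * (+ (n !) * (c * down f S))
        ≡⟨ identity₄ (+ (n !)) c (down f S) ⟩
      0ℤ ∎
      where
      identity₄ : ∀ a b d → a * b * d + - 1ℤ * (a * (b * d)) ≡ 0ℤ
      identity₄ = solve-∀

  -- Nonnegativity, definiteness and diagonal expansion of the inner product.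

  sumBelow-add : ∀ k f g → sumBelow k (λ j → f j + g j) ≡ sumBelow k f + sumBelow k g
  sumBelow-add zero    f g = refl
  sumBelow-add (suc k) f g = trans (cong (λ s → (f k + g k) + s) (sumBelow-add k f g))
    (identity (f k) (g k) (sumBelow k f) (sumBelow k g))
    where
    identity : ∀ a b c d → (a + b) + (c + d) ≡ (a + c) + (b + d)
    identity = solve-∀

  sumBelow-suc : ∀ k f → sumBelow (suc k) f ≡ sumBelow k (f ∘ suc) + f 0
  sumBelow-suc zero    f = +-comm (f 0) 0ℤ
  sumBelow-suc (suc k) f = trans (cong (λ s → f (suc k) + s) (sumBelow-suc k f))
    (sym (+-assoc (f (suc k)) (sumBelow k (f ∘ suc)) (f 0)))

  sumBelow-zero : ∀ k {f} → (∀ j → j ℕ.< k → f j ≡ 0ℤ) → sumBelow k f ≡ 0ℤ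
  sumBelow-zero zero    e = refl
  sumBelow-zero (suc k) e = cong₂ _+_ (e k (ℕ.n<1+n k)) (sumBelow-zero k (λ j p → e j (ℕ.m<n⇒m<1+n p)))

  sumBelow-single : ∀ k {f} i → i ℕ.< k → (∀ j → j ≢ i → f j ≡ 0ℤ) → sumBelow k f ≡ f i
  sumBelow-single (suc k) {f} i i<k e with k ℕ.≟ i
  ... | yes refl = trans (cong (λ s → f k + s) (sumBelow-zero k (λ j j<k → e j (ℕ.<⇒≢ j<k)))) (+-identityʳ (f k))
  ... | no k≢i   = trans (cong₂ _+_ (e k k≢i) (sumBelow-single k i (ℕ.≤∧≢⇒< (ℕ.≤-pred i<k) (k≢i ∘ sym)) e))
    (+-identityˡ (f i))

  0≤+ : ∀ {m} → 0ℤ ≤ + m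
  0≤+ = +≤+ z≤n

  *-nonneg : ∀ {a b} → 0ℤ ≤ a → 0ℤ ≤ b → 0ℤ ≤ a * b
  *-nonneg {+ m} {+ n} _ _ = subst (0ℤ ≤_) (pos-* m n) 0≤+

  square-nonneg : ∀ a → 0ℤ ≤ a * a
  square-nonneg (+ m)    = subst (0ℤ ≤_) (pos-* m m) 0≤+
  square-nonneg -[1+ m ] = 0≤+

  +-nonneg-zeroˡ : ∀ {a b} → 0ℤ ≤ a → 0ℤ ≤ b → a + b ≡ 0ℤ → a ≡ 0ℤ
  +-nonneg-zeroˡ {+ m} {+ n} _ _ e = cong +_ (ℕ.m+n≡0⇒m≡0 m (+-injective e))

  +-nonneg-zeroʳ : ∀ {a b} → 0ℤ ≤ a → 0ℤ ≤ b → a + b ≡ 0ℤ → b ≡ 0ℤ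
  +-nonneg-zeroʳ {a} {b} p q e = +-nonneg-zeroˡ q p (trans (+-comm b a) e)

  sumBelow-nonneg : ∀ k {f} → (∀ j → j ℕ.< k → 0ℤ ≤ f j) → 0ℤ ≤ sumBelow k f
  sumBelow-nonneg zero    p = 0≤+
  sumBelow-nonneg (suc k) p = +-mono-≤ (p k (ℕ.n<1+n k)) (sumBelow-nonneg k (λ j q → p j (ℕ.m<n⇒m<1+n q)))

  sumBelow-nonneg-zero : ∀ k {f} → (∀ j → j ℕ.< k → 0ℤ ≤ f j) → sumBelow k f ≡ 0ℤ →
                         ∀ j → j ℕ.< k → f j ≡ 0ℤ
  sumBelow-nonneg-zero (suc k) {f} p e j j<1+k with j ℕ.≟ k
  ... | yes refl = +-nonneg-zeroˡ (p k (ℕ.n<1+n k)) (sumBelow-nonneg k (λ j q → p j (ℕ.m<n⇒m<1+n q))) e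
  ... | no j≢k   = sumBelow-nonneg-zero k (λ j q → p j (ℕ.m<n⇒m<1+n q))
    (+-nonneg-zeroʳ {f k} (p k (ℕ.n<1+n k)) (sumBelow-nonneg k (λ j q → p j (ℕ.m<n⇒m<1+n q))) e)
    j (ℕ.≤∧≢⇒< (ℕ.≤-pred j<1+k) j≢k)

  ∑-nonneg : ∀ {n} {f : Fn n} → (∀ S → 0ℤ ≤ f S) → 0ℤ ≤ ∑ f
  ∑-nonneg {zero}  p = p []
  ∑-nonneg {suc n} p = +-mono-≤ (∑-nonneg (λ S → p (true ∷ S))) (∑-nonneg (λ S → p (false ∷ S)))

  ∑-nonneg-zero : ∀ {n} {f : Fn n} → (∀ S → 0ℤ ≤ f S) → ∑ f ≡ 0ℤ → ∀ S → f S ≡ 0ℤ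
  ∑-nonneg-zero {zero}  p e []          = e
  ∑-nonneg-zero {suc n} {f} p e (true ∷ S)  = ∑-nonneg-zero (λ S → p (true ∷ S))
    (+-nonneg-zeroˡ (∑-nonneg (λ S → p (true ∷ S))) (∑-nonneg (λ S → p (false ∷ S))) e) S
  ∑-nonneg-zero {suc n} {f} p e (false ∷ S) = ∑-nonneg-zero (λ S → p (false ∷ S))
    (+-nonneg-zeroʳ {∑ (slice true f)} (∑-nonneg (λ S → p (true ∷ S))) (∑-nonneg (λ S → p (false ∷ S))) e) S

  level-square-nonneg : ∀ {n} k (f : Fn n) S → 0ℤ ≤ level k (λ T → f T * f T) S
  level-square-nonneg k f S = *-nonneg (δ-nonneg k ∣ S ∣) (square-nonneg (f S))
    where
    δ-nonneg : ∀ k m → 0ℤ ≤ δ k m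
    δ-nonneg zero    zero    = 0≤+
    δ-nonneg zero    (suc m) = 0≤+
    δ-nonneg (suc k) zero    = 0≤+
    δ-nonneg (suc k) (suc m) = δ-nonneg k m

  inner-nonneg : ∀ {n} k (f : Fn n) → 0ℤ ≤ inner k f f
  inner-nonneg k f = ∑-nonneg (level-square-nonneg k f)

  inner-definite : ∀ {n} k (f : Fn n) → inner k f f ≡ 0ℤ → ∀ S → ∣ S ∣ ≡ k → f S ≡ 0ℤ
  inner-definite k f e S ∣S∣≡k = [ id , id ]′ (i*j≡0⇒i≡0∨j≡0 (f S)
    (trans (sym (level-at k (λ T → f T * f T) S ∣S∣≡k)) (∑-nonneg-zero (level-square-nonneg k f) e S)))

  inner-sumʳ : ∀ {n} k K (f : Fn n) (F : ℕ → Fn n) →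
               inner k f (λ S → sumBelow K (λ j → F j S)) ≡ sumBelow K (λ j → inner k f (F j))
  inner-sumʳ k zero    f F = ∑-zero (λ S → trans (cong (λ t → δ k ∣ S ∣ * t) (*-zeroʳ (f S))) (*-zeroʳ (δ k ∣ S ∣)))
  inner-sumʳ k (suc K) f F = trans (inner-plusʳ k f (F K) (λ S → sumBelow K (λ j → F j S)))
    (cong (λ s → inner k f (F K) + s) (inner-sumʳ k K f F))

  inner-sumᴴ : ∀ {n} k K (H : ∀ j → Harmonic n j) {j} (G : Harmonic n j) → j ℕ.< K →
               inner k (λ S → sumBelow K (λ i → extension (H i) S)) (extension G) ≡
               inner k (extension (H j)) (extension G)
  inner-sumᴴ k K H {j} G j<K = begin
    inner k (λ S → sumBelow K (λ i → extension (H i) S)) (extension G)  ≡⟨ inner-comm k _ (extension G) ⟩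
    inner k (extension G) (λ S → sumBelow K (λ i → extension (H i) S))
      ≡⟨ inner-sumʳ k K (extension G) (λ i → extension (H i)) ⟩
    sumBelow K (λ i → inner k (extension G) (extension (H i)))
      ≡⟨ sumBelow-single K j j<K (λ i i≢j → orthogonal G (H i) (i≢j ∘ sym) k) ⟩
    inner k (extension G) (extension (H j))
      ≡⟨ inner-comm k (extension G) (extension (H j)) ⟩
    inner k (extension (H j)) (extension G)                             ∎

  inner-expand : ∀ {n} k K (H : ∀ j → Harmonic n j) (θ : ℕ → ℤ) →
                 inner k (λ S → sumBelow K (λ j → extension (H j) S)) (λ S → sumBelow K (λ j → θ j * extension (H j) S)) ≡
                 sumBelow K (λ j → θ j * inner k (extension (H j)) (extension (H j)))
  inner-expand k K H θ = trans (inner-sumʳ k K F (λ j S → θ j * extension (H j) S))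
    (sumBelow-cong K (λ j j<K → trans (inner-scaleʳ k (θ j) F (extension (H j)))
      (cong (λ t → θ j * t) (inner-sumᴴ k K H (H j) j<K))))
    where
    F : Fn _
    F S = sumBelow K (λ j → extension (H j) S)

  -- Binomial counts and the constant function.

  ∑-level-one : ∀ n k → ∑ {n} (level k (λ _ → 1ℤ)) ≡ + (n C k)
  ∑-level-one zero    zero    = refl
  ∑-level-one zero    (suc k) = cong +_ (sym (k>n⇒nCk≡0 {0} {suc k} (s≤s z≤n)))
  ∑-level-one (suc n) zero    = trans (cong₂ _+_ (∑-zero {n} (λ S → refl)) (∑-level-one n zero))
    (trans (+-identityˡ _) (cong +_ (trans (nC0≡1 n) (sym (nC0≡1 (suc n))))))
  ∑-level-one (suc n) (suc k) = trans (cong₂ _+_ (∑-level-one n k) (∑-level-one n (suc k)))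
    (cong +_ (nCk+nC[k+1]≡[n+1]C[k+1] n k))

  subsetSum-constant : ∀ {n} (f : Fn n) → SupportedOn 0 f → ∀ S → subsetSum f S ≡ f ∅
  subsetSum-constant f supp []          = refl
  subsetSum-constant f supp (true ∷ S)  = trans
    (cong₂ (λ s t → 1ℤ * s + 1ℤ * t) (tens-zero bᵐ (λ T → supp (true ∷ T) (λ ())) S)
      (subsetSum-constant (slice false f) (λ T → supp (false ∷ T)) S))
    (identity (f ∅))
    where
    identity : ∀ a → 1ℤ * 0ℤ + 1ℤ * a ≡ a
    identity = solve-∀
  subsetSum-constant f supp (false ∷ S) = trans
    (cong₂ (λ s t → 0ℤ * s + 1ℤ * t) (tens-zero bᵐ (λ T → supp (true ∷ T) (λ ())) S)
      (subsetSum-constant (slice false f) (λ T → supp (false ∷ T)) S))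
    (identity (f ∅))
    where
    identity : ∀ a → 0ℤ * 0ℤ + 1ℤ * a ≡ a
    identity = solve-∀

  -- The constant function as a member of the family: by orthogonality, pairing with its extension
  -- isolates the component of degree 0.
  one : ∀ n → Harmonic n 0
  one n = levelᴴ 0 (λ _ → 1ℤ) (λ S ())

  extension-one : ∀ {n} S → extension (one n) S ≡ 1ℤ
  extension-one {n} S = trans (subsetSum-constant (fun (one n)) (supported (one n)) S) (level-at {n} 0 (λ _ → 1ℤ) ∅ (∣⊥∣≡0 n))

  -- By Pascal's rule binomials grow along diagonals. The eigenvalue of degree j has absolute value
  -- C(n-k-j, k-j), so among degrees j ≥ 1 it is largest at j = 1.
  C-diagonal-mono : ∀ i m r → m C r ℕ.≤ (i ℕ.+ m) C (i ℕ.+ r)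
  C-diagonal-mono zero    m r = ℕ.≤-refl
  C-diagonal-mono (suc i) m r = ℕ.≤-trans (C-diagonal-mono i m r)
    (ℕ.≤-trans (ℕ.m≤m+n _ _) (ℕ.≤-reflexive (nCk+nC[k+1]≡[n+1]C[k+1] (i ℕ.+ m) (i ℕ.+ r))))

  C-positive : ∀ {m r} → r ℕ.≤ m → 0 ℕ.< m C r
  C-positive {m} {r} r≤m = subst₂ (λ a b → 0 ℕ.< a C b) (ℕ.m+[n∸m]≡n r≤m) (ℕ.+-identityʳ r)
    (ℕ.<-≤-trans (ℕ.≤-reflexive (sym (nC0≡1 (m ℕ.∸ r)))) (C-diagonal-mono r (m ℕ.∸ r) 0))

  sign-±1 : ∀ j → sign j ≡ 1ℤ ⊎ sign j ≡ - 1ℤ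
  sign-±1 zero    = inj₁ refl
  sign-±1 (suc j) = [ (λ e → inj₂ (cong -_ e)) , (λ e → inj₁ (cong -_ e)) ]′ (sign-±1 j)

  -- In KG(n, k + 1) with n = k + 1 + m + 1: the degree is d = C(m + 1, k + 1), the least
  -- eigenvalue is − C(m, k), and Hoffman's bound N l / (d + l) equals C(n − 1, k).
  kneser-count : ∀ k m → (m C k) ℕ.* ((suc k ℕ.+ suc m) C suc k) ≡
                 (suc m C suc k ℕ.+ m C k) ℕ.* ((k ℕ.+ suc m) C k)
  kneser-count k m = ℕ.*-cancelˡ-≡ _ _ (suc k) (begin
    suc k ℕ.* (l ℕ.* N)                    ≡⟨ identity₁ (suc k) l N ⟩
    l ℕ.* (suc k ℕ.* N)                    ≡⟨ cong (l ℕ.*_) (absorption (k ℕ.+ suc m) k) ⟩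
    l ℕ.* (suc (k ℕ.+ suc m) ℕ.* M)        ≡⟨ identity₂ l k m M ⟩
    (suc m ℕ.* l ℕ.+ suc k ℕ.* l) ℕ.* M    ≡⟨ cong (λ t → (t ℕ.+ suc k ℕ.* l) ℕ.* M) (absorption m k) ⟨
    (suc k ℕ.* d ℕ.+ suc k ℕ.* l) ℕ.* M    ≡⟨ identity₃ (suc k) d l M ⟩
    suc k ℕ.* ((d ℕ.+ l) ℕ.* M)            ∎)
    where
    l d N M : ℕ
    l = m C k
    d = suc m C suc k
    N = (suc k ℕ.+ suc m) C suc k
    M = (k ℕ.+ suc m) C k
    identity₁ : ∀ a b c → a ℕ.* (b ℕ.* c) ≡ b ℕ.* (a ℕ.* c)
    identity₁ = ℕ-Solver.solve-∀
    identity₂ : ∀ l k m M → l ℕ.* (suc (k ℕ.+ suc m) ℕ.* M) ≡ (suc m ℕ.* l ℕ.+ suc k ℕ.* l) ℕ.* M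
    identity₂ = ℕ-Solver.solve-∀
    identity₃ : ∀ k d l M → (k ℕ.* d ℕ.+ k ℕ.* l) ℕ.* M ≡ k ℕ.* ((d ℕ.+ l) ℕ.* M)
    identity₃ = ℕ-Solver.solve-∀

  -- The ratio bound and its case of equality.

  module RatioBound {k m : ℕ} (k≤m : k ℕ.≤ m) (f : Fn (suc k ℕ.+ suc m))
    (f-supported : SupportedOn (suc k) f)
    (f-idempotent : ∀ S → f S * f S ≡ f S)
    (f-independent : ∀ S → f S * disjointSum f S ≡ 0ℤ) where

    -- The sets have size k + 1 and n = (k + 1) + (m + 1), so 2(k + 1) ≤ n becomes k ≤ m and every
    -- binomial is free of truncated subtraction. The hypotheses on f are those of an indicator, put
    -- algebraically.
    n d l N M : ℕ
    n = suc k ℕ.+ suc m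
    d = suc m C suc k
    l = m C k
    N = n C suc k
    M = (k ℕ.+ suc m) C k

    open Decomposition (decompose (suc k) (ℕ.+-monoʳ-≤ (suc k) (s≤s k≤m)) f)
      renaming (scale to c; scale≢0 to c≢0)

    φ : ℕ → Fn n
    φ j = extension (component j)

    F : Fn n
    F S = sumBelow (suc (suc k)) (λ j → φ j S)

    -- Eigenvalues of the adjacency operator and of its shift by l. The shift is chosen so that θ 1
    -- = 0.
    μ θ : ℕ → ℤ
    μ j = sign j * + ((suc m ℕ.∸ j) C (suc k ℕ.∸ j))
    θ j = μ j + + l

    s a : ℤ
    s = ∑ f
    a = fun (component 0) ∅

    eigen : ∀ j → j ℕ.≤ suc k → ∀ S → ∣ S ∣ ≡ suc k → disjointSum (level (suc k) (φ j)) S ≡ μ j * φ j S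
    eigen j j≤k S e = begin
      disjointSum (level (suc k) (φ j)) S
        ≡⟨ cong (λ t → disjointSum (level t (φ j)) S) (ℕ.m∸n+n≡m j≤k) ⟨
      disjointSum (level (suc k ℕ.∸ j ℕ.+ j) (φ j)) S
        ≡⟨ disjointSum-extension (component j) (suc k ℕ.∸ j) (suc m ℕ.∸ j) S sizes (ℕ.∸-monoˡ-≤ j (s≤s k≤m)) ⟩
      + ((suc m ℕ.∸ j) C (suc k ℕ.∸ j)) * (sign j * φ j S)
        ≡⟨ identity (+ ((suc m ℕ.∸ j) C (suc k ℕ.∸ j))) (sign j) (φ j S) ⟩
      μ j * φ j S ∎
      where
      sizes : ∣ S ∣ ℕ.+ j ℕ.+ (suc m ℕ.∸ j) ≡ n
      sizes = trans (ℕ.+-assoc ∣ S ∣ j (suc m ℕ.∸ j))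
        (cong₂ ℕ._+_ e (ℕ.m+[n∸m]≡n (ℕ.≤-trans j≤k (s≤s k≤m))))
      identity : ∀ a b c → a * (b * c) ≡ (b * a) * c
      identity = solve-∀

    θ-nonneg : ∀ j → j ℕ.≤ k → 0ℤ ≤ θ (suc j)
    θ-nonneg j j≤k = [ (λ e → subst (λ t → 0ℤ ≤ t * + c′ + + l) (sym e)
                         (subst (λ t → 0ℤ ≤ t + + l) (sym (*-identityˡ (+ c′))) 0≤+))
                     , (λ e → subst (λ t → 0ℤ ≤ t * + c′ + + l) (sym e)
                         (subst (0ℤ ≤_) (identity (+ l) (+ c′)) (i≤j⇒0≤j-i (+≤+ c′≤l)))) ]′
                     (sign-±1 (suc j))
      where
      c′ : ℕ
      c′ = (m ℕ.∸ j) C (k ℕ.∸ j)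
      c′≤l : c′ ℕ.≤ l
      c′≤l = subst₂ (λ x y → c′ ℕ.≤ x C y) (ℕ.m+[n∸m]≡n (ℕ.≤-trans j≤k k≤m)) (ℕ.m+[n∸m]≡n j≤k)
        (C-diagonal-mono j (m ℕ.∸ j) (k ℕ.∸ j))
      identity : ∀ l c → l - c ≡ - 1ℤ * c + l
      identity = solve-∀

    θ₀ : θ 0 ≡ + (d ℕ.+ l)
    θ₀ = cong (λ t → t + + l) (*-identityˡ (+ d))

    φ₀ : ∀ S → φ 0 S ≡ a
    φ₀ = subsetSum-constant (fun (component 0)) (supported (component 0))

    transform : ∀ S → ∣ S ∣ ≡ suc k →
                c * (disjointSum f S + + l * f S) ≡ sumBelow (suc (suc k)) (λ j → θ j * φ j S)
    transform S e = begin
      c * (disjointSum f S + + l * f S)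
        ≡⟨ identity₁ c (disjointSum f S) (+ l) (f S) ⟩
      c * disjointSum f S + + l * (c * f S)
        ≡⟨ cong₂ _+_ neighbours (cong (λ t → + l * t) (total S e)) ⟩
      sumBelow (suc (suc k)) (λ j → μ j * φ j S) + + l * F S
        ≡⟨ cong (λ t → sumBelow (suc (suc k)) (λ j → μ j * φ j S) + t) (sumBelow-scale (suc (suc k)) (+ l) (λ j → φ j S)) ⟨
      sumBelow (suc (suc k)) (λ j → μ j * φ j S) + sumBelow (suc (suc k)) (λ j → + l * φ j S)
        ≡⟨ sumBelow-add (suc (suc k)) (λ j → μ j * φ j S) (λ j → + l * φ j S) ⟨
      sumBelow (suc (suc k)) (λ j → μ j * φ j S + + l * φ j S)
        ≡⟨ sumBelow-cong (suc (suc k)) (λ j _ → *-distribʳ-+ (φ j S) (μ j) (+ l)) ⟨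
      sumBelow (suc (suc k)) (λ j → θ j * φ j S) ∎
      where
      identity₁ : ∀ c d l f → c * (d + l * f) ≡ c * d + l * (c * f)
      identity₁ = solve-∀
      -- `total` speaks only of the (k+1)-sets, while `disjointSum` sees sets of every size; the
      -- support of f bridges the two.
      restrict : ∀ T → c * f T ≡ sumBelow (suc (suc k)) (λ j → level (suc k) (φ j) T)
      restrict T = begin
        c * f T
          ≡⟨ level-supported (suc k) (supported-scale (suc k) c f-supported) T ⟨
        level (suc k) (λ T → c * f T) T        ≡⟨ level-cong (suc k) total T ⟩
        level (suc k) F T                      ≡⟨ sumBelow-scale (suc (suc k)) (δ (suc k) ∣ T ∣) (λ j → φ j T) ⟨
        sumBelow (suc (suc k)) (λ j → level (suc k) (φ j) T) ∎
      neighbours : c * disjointSum f S ≡ sumBelow (suc (suc k)) (λ j → μ j * φ j S)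
      neighbours = begin
        c * disjointSum f S                    ≡⟨ tens-scale aᵐ c f S ⟨
        disjointSum (λ T → c * f T) S          ≡⟨ tens-cong aᵐ restrict S ⟩
        disjointSum (λ T → sumBelow (suc (suc k)) (λ j → level (suc k) (φ j) T)) S
          ≡⟨ tens-sumBelow aᵐ (suc (suc k)) (λ j → level (suc k) (φ j)) S ⟩
        sumBelow (suc (suc k)) (λ j → disjointSum (level (suc k) (φ j)) S)
          ≡⟨ sumBelow-cong (suc (suc k)) (λ j j<k → eigen j (ℕ.≤-pred j<k) S e) ⟩
        sumBelow (suc (suc k)) (λ j → μ j * φ j S) ∎

    norm : ℕ → ℤ
    norm j = inner (suc k) (φ j) (φ j)

    R : ℤ
    R = sumBelow (suc k) (λ j → θ (suc j) * norm (suc j))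

    terms-nonneg : ∀ j → j ℕ.< suc k → 0ℤ ≤ θ (suc j) * norm (suc j)
    terms-nonneg j j<k = *-nonneg (θ-nonneg j (ℕ.≤-pred j<k)) (inner-nonneg (suc k) (φ (suc j)))

    inner-one : inner {n} (suc k) (λ _ → 1ℤ) (λ _ → 1ℤ) ≡ + N
    inner-one = ∑-level-one n (suc k)

    mean : c * s ≡ a * + N
    mean = begin
      c * ∑ f                               ≡⟨ ∑-scale c f ⟨
      ∑ (λ S → c * f S)
        ≡⟨ ∑-cong (λ S → trans (sym (level-supported (suc k) (supported-scale (suc k) c f-supported) S))
             (level-cong (suc k) (λ T _ → trans (sym (*-identityʳ (c * f T)))
               (cong (λ t → c * f T * t) (sym (extension-one {n} T)))) S)) ⟩
      inner (suc k) (λ S → c * f S) u       ≡⟨ inner-cong (suc k) {g = u} total (λ _ _ → refl) ⟩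
      inner (suc k) F u                     ≡⟨ inner-sumᴴ (suc k) (suc (suc k)) component (one n) (s≤s z≤n) ⟩
      inner (suc k) (φ 0) u
        ≡⟨ inner-cong (suc k) (λ S _ → trans (φ₀ S) (sym (*-identityʳ a))) (λ S _ → extension-one {n} S) ⟩
      inner {n} (suc k) (λ _ → a * 1ℤ) (λ _ → 1ℤ)  ≡⟨ inner-comm {n} (suc k) (λ _ → a * 1ℤ) (λ _ → 1ℤ) ⟩
      inner {n} (suc k) (λ _ → 1ℤ) (λ _ → a * 1ℤ)  ≡⟨ inner-scaleʳ {n} (suc k) a (λ _ → 1ℤ) (λ _ → 1ℤ) ⟩
      a * inner {n} (suc k) (λ _ → 1ℤ) (λ _ → 1ℤ)  ≡⟨ cong (λ t → a * t) inner-one ⟩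
      a * + N                               ∎
      where
      u : Fn n
      u = extension (one n)

    norm₀ : norm 0 ≡ a * a * + N
    norm₀ = begin
      norm 0
        ≡⟨ ∑-cong (λ S → trans (cong (λ t → δ (suc k) ∣ S ∣ * (t * t)) (φ₀ S)) (identity (δ (suc k) ∣ S ∣) a)) ⟩
      ∑ {n} (λ S → a * a * level (suc k) (λ _ → 1ℤ) S)  ≡⟨ ∑-scale {n} (a * a) (level (suc k) (λ _ → 1ℤ)) ⟩
      a * a * ∑ {n} (level (suc k) (λ _ → 1ℤ))     ≡⟨ cong (λ t → a * a * t) (∑-level-one n (suc k)) ⟩
      a * a * + N                              ∎
      where
      identity : ∀ d a → d * (a * a) ≡ a * a * (d * 1ℤ)
      identity = solve-∀

    -- The quadratic form of the shifted operator at c f, computed twice: independence removes the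
    -- adjacency term and leaves l times the size, while the decomposition diagonalises the form.
    energy : c * c * (+ l * s) ≡ R + θ 0 * (a * a * + N)
    energy = begin
      c * c * (+ l * ∑ f)
        ≡⟨ identity₁ c (+ l) (∑ f) ⟩
      c * c * + l * ∑ f
        ≡⟨ ∑-scale (c * c * + l) f ⟨
      ∑ (λ S → c * c * + l * f S)
        ≡⟨ ∑-cong (λ S → trans (sym (level-supported (suc k) (supported-scale (suc k) (c * c * + l) f-supported) S))
             (cong (λ t → δ (suc k) ∣ S ∣ * t) (pointwise S))) ⟩
      inner (suc k) (λ S → c * f S) (λ S → c * (disjointSum f S + + l * f S))
        ≡⟨ inner-cong (suc k) total transform ⟩
      inner (suc k) F (λ S → sumBelow (suc (suc k)) (λ j → θ j * φ j S))
        ≡⟨ inner-expand (suc k) (suc (suc k)) component θ ⟩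
      sumBelow (suc (suc k)) (λ j → θ j * norm j)
        ≡⟨ sumBelow-suc (suc k) (λ j → θ j * norm j) ⟩
      R + θ 0 * norm 0
        ≡⟨ cong (λ t → R + θ 0 * t) norm₀ ⟩
      R + θ 0 * (a * a * + N) ∎
      where
      identity₁ : ∀ c l s → c * c * (l * s) ≡ c * c * l * s
      identity₁ = solve-∀
      pointwise : ∀ S → c * c * + l * f S ≡ (c * f S) * (c * (disjointSum f S + + l * f S))
      pointwise S = sym (begin
        (c * f S) * (c * (disjointSum f S + + l * f S))
          ≡⟨ identity₂ c (f S) (disjointSum f S) (+ l) ⟩
        c * c * (f S * disjointSum f S) + c * c * + l * (f S * f S)
          ≡⟨ cong₂ (λ x y → c * c * x + c * c * + l * y) (f-independent S) (f-idempotent S) ⟩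
        c * c * 0ℤ + c * c * + l * f S
          ≡⟨ identity₃ c (+ l) (f S) ⟩
        c * c * + l * f S ∎)
        where
        identity₂ : ∀ c f d l → (c * f) * (c * (d + l * f)) ≡ c * c * (f * d) + c * c * l * (f * f)
        identity₂ = solve-∀
        identity₃ : ∀ c l f → c * c * 0ℤ + c * c * l * f ≡ c * c * l * f
        identity₃ = solve-∀

    lN≡θM : + l * + N ≡ θ 0 * + M
    lN≡θM = trans (sym (pos-* l N)) (trans (cong +_ (kneser-count k m))
      (trans (pos-* (d ℕ.+ l) M) (cong (λ t → t * + M) (sym θ₀))))

    -- Hoffman's bound as an identity without division, obtained by eliminating a through `mean`.
    -- Since R ≥ 0 it forces s ≤ M, and s = M forces R = 0.
    deficit : c * c * θ 0 * s * (+ M - s) ≡ R * + N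
    deficit = begin
      c * c * θ 0 * s * (+ M - s)
        ≡⟨ identity₁ c (θ 0) s (+ M) ⟩
      c * c * s * (θ 0 * + M) - θ 0 * ((c * s) * (c * s))
        ≡⟨ cong₂ (λ x y → c * c * s * x - θ 0 * (y * y)) (sym lN≡θM) mean ⟩
      c * c * s * (+ l * + N) - θ 0 * ((a * + N) * (a * + N))
        ≡⟨ identity₂ c s (+ l) (+ N) (θ 0) a ⟩
      (c * c * (+ l * s) - θ 0 * (a * a * + N)) * + N
        ≡⟨ cong (λ t → (t - θ 0 * (a * a * + N)) * + N) energy ⟩
      (R + θ 0 * (a * a * + N) - θ 0 * (a * a * + N)) * + N
        ≡⟨ identity₃ R (θ 0 * (a * a * + N)) (+ N) ⟩
      R * + N ∎
      where
      identity₁ : ∀ c t s M → c * c * t * s * (M - s) ≡ c * c * s * (t * M) - t * ((c * s) * (c * s))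
      identity₁ = solve-∀
      identity₂ : ∀ c s l N t a → c * c * s * (l * N) - t * ((a * N) * (a * N)) ≡ (c * c * (l * s) - t * (a * a * N)) * N
      identity₂ = solve-∀
      identity₃ : ∀ r x N → (r + x - x) * N ≡ r * N
      identity₃ = solve-∀

    N≢0 : + N ≢ 0ℤ
    N≢0 e = ℕ.>⇒≢ (C-positive (ℕ.m≤m+n (suc k) (suc m))) (+-injective e)

    θ₀≢0 : θ 0 ≢ 0ℤ
    θ₀≢0 e = ℕ.>⇒≢ (ℕ.<-≤-trans (C-positive k≤m) (ℕ.m≤n+m l d)) (+-injective (trans (sym θ₀) e))

    size-bound : ∀ t → s ≡ + t → t ℕ.≤ M
    size-bound t s≡t with t ℕ.≤? M
    ... | yes t≤M = t≤M
    -- With w = t - M > 0 the identity `deficit` reads P w + R N = 0: both summands are nonnegative,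
    -- yet P w is not zero.
    ... | no t≰M = contradiction (+-nonneg-zeroˡ {P * + w} {R * + N}
        (*-nonneg P≥0 0≤+)
        (*-nonneg (sumBelow-nonneg (suc k) terms-nonneg) 0≤+)
        (trans (cong (λ x → P * + w + x) (sym deficit)) cancel))
      (*-≢0 P (+ w) (*-≢0 (c * c * θ 0) s (*-≢0 (c * c) (θ 0) (*-≢0 c c c≢0 c≢0) θ₀≢0) s≢0) w≢0)
      where
      P : ℤ
      P = c * c * θ 0 * s
      w : ℕ
      w = t ℕ.∸ M
      M<t : M ℕ.< t
      M<t = ℕ.≰⇒> t≰M
      w≢0 : + w ≢ 0ℤ
      w≢0 e = ℕ.m>n⇒m∸n≢0 M<t (+-injective e)
      s≢0 : s ≢ 0ℤ
      s≢0 e = ℕ.>⇒≢ (ℕ.≤-<-trans z≤n M<t) (+-injective (trans (sym s≡t) e))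
      P≥0 : 0ℤ ≤ P
      P≥0 = *-nonneg (*-nonneg (square-nonneg c) (subst (0ℤ ≤_) (sym θ₀) 0≤+)) (subst (0ℤ ≤_) (sym s≡t) 0≤+)
      cancel : P * + w + P * (+ M - s) ≡ 0ℤ
      cancel = begin
        P * + w + P * (+ M - s)
          ≡⟨ cong (λ x → P * + w + P * (+ M - x)) (trans s≡t (cong +_ (sym (ℕ.m+[n∸m]≡n (ℕ.<⇒≤ M<t))))) ⟩
        P * + w + P * (+ M - (+ M + + w))  ≡⟨ identity P (+ w) (+ M) ⟩
        0ℤ ∎
        where
        identity : ∀ p w m → p * w + p * (m - (m + w)) ≡ 0ℤ
        identity = solve-∀

    -- R = 0 makes each term θ j · norm j with j ≥ 1 vanish, so either the shifted eigenvalue is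
    -- zero or the component is. The shifted operator thus sends c f to the constant θ 0 · a, which
    -- `mean` and `lN≡θM` identify as c l.
    tight : s ≡ + M → ∀ S → ∣ S ∣ ≡ suc k → f S ≡ 0ℤ → disjointSum f S ≡ + l
    tight s≡M S e fS≡0 = i-j≡0⇒i≡j (disjointSum f S) (+ l) ([ (λ z → contradiction z (*-≢0 c (+ N) c≢0 N≢0)) , id ]′
      (i*j≡0⇒i≡0∨j≡0 (c * + N) (begin
        c * + N * (disjointSum f S - + l)
          ≡⟨ identity₁ c (+ N) (disjointSum f S) (+ l) ⟩
        c * (disjointSum f S + + l * 0ℤ) * + N - c * (+ l * + N)
          ≡⟨ cong₂ (λ x y → c * (disjointSum f S + + l * x) * + N - c * y) (sym fS≡0) lN≡θM ⟩
        c * (disjointSum f S + + l * f S) * + N - c * (θ 0 * + M)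
          ≡⟨ cong₂ (λ x y → x * + N - c * (θ 0 * y)) (trans (transform S e) collapse) (sym s≡M) ⟩
        θ 0 * a * + N - c * (θ 0 * s)
          ≡⟨ identity₂ (θ 0) a (+ N) c s ⟩
        θ 0 * (a * + N) - θ 0 * (c * s)
          ≡⟨ cong (λ x → θ 0 * (a * + N) - θ 0 * x) mean ⟩
        θ 0 * (a * + N) - θ 0 * (a * + N)
          ≡⟨ +-inverseʳ (θ 0 * (a * + N)) ⟩
        0ℤ ∎)))
      where
      identity₁ : ∀ c N d l → c * N * (d - l) ≡ c * (d + l * 0ℤ) * N - c * (l * N)
      identity₁ = solve-∀
      identity₂ : ∀ t a N c s → t * a * N - c * (t * s) ≡ t * (a * N) - t * (c * s)
      identity₂ = solve-∀
      R≡0 : R ≡ 0ℤ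
      R≡0 = [ id , (λ z → contradiction z N≢0) ]′ (i*j≡0⇒i≡0∨j≡0 R (trans (sym deficit)
        (trans (cong (λ x → c * c * θ 0 * s * (+ M - x)) s≡M)
          (trans (cong (λ x → c * c * θ 0 * s * x) (+-inverseʳ (+ M))) (*-zeroʳ (c * c * θ 0 * s))))))
      vanish : ∀ j → j ℕ.< suc k → θ (suc j) * φ (suc j) S ≡ 0ℤ
      vanish j j<k = [ (λ z → trans (cong (_* φ (suc j) S) z) (*-zeroˡ (φ (suc j) S)))
                     , (λ z → trans (cong (λ x → θ (suc j) * x) (inner-definite (suc k) (φ (suc j)) z S e))
                              (*-zeroʳ (θ (suc j)))) ]′
        (i*j≡0⇒i≡0∨j≡0 (θ (suc j)) (sumBelow-nonneg-zero (suc k) terms-nonneg R≡0 j j<k))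
      collapse : sumBelow (suc (suc k)) (λ j → θ j * φ j S) ≡ θ 0 * a
      collapse = begin
        sumBelow (suc (suc k)) (λ j → θ j * φ j S)      ≡⟨ sumBelow-suc (suc k) (λ j → θ j * φ j S) ⟩
        sumBelow (suc k) (λ j → θ (suc j) * φ (suc j) S) + θ 0 * φ 0 S
          ≡⟨ cong₂ (λ x y → x + θ 0 * y) (sumBelow-zero (suc k) vanish) (φ₀ S) ⟩
        0ℤ + θ 0 * a                                    ≡⟨ +-identityˡ (θ 0 * a) ⟩
        θ 0 * a                                         ∎

  -- Vertex sets as functions on subsets.

  χ : Bool → ℤ
  χ true  = 1ℤ
  χ false = 0ℤ

  χ-∧ : ∀ x y → χ (x ∧ y) ≡ χ x * χ y
  χ-∧ true  y = sym (*-identityˡ (χ y))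
  χ-∧ false y = sym (*-zeroˡ (χ y))

  χ-idem : ∀ x → χ x * χ x ≡ χ x
  χ-idem true  = refl
  χ-idem false = refl

  χ-does : ∀ {P : Set} (P? : Dec P) {t} → (P → t ≡ 1ℤ) → (¬ P → t ≡ 0ℤ) → χ (does P?) ≡ t
  χ-does (yes p) e₁ e₀ = sym (e₁ p)
  χ-does (no ¬p) e₁ e₀ = sym (e₀ ¬p)

  vertexIndex : ∀ {n k} → KSubset n k → Fin (#KSubset n k)
  vertexIndex {n} {k} = Inverse.to (KSubset↔Fin n k)

  extendByZero : ∀ {n k} → (KSubset n k → ℤ) → Fn n
  extendByZero {k = k} g S with ∣ S ∣ ℕ.≟ k
  ... | yes e = g (S , e)
  ... | no  _ = 0ℤ

  extendByZero-at : ∀ {n k} (g : KSubset n k → ℤ) (v : KSubset n k) → extendByZero g (proj₁ v) ≡ g v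
  extendByZero-at {k = k} g (S , e) with ∣ S ∣ ℕ.≟ k
  ... | yes e′ = cong g (KSubset-≡ refl)
  ... | no ¬e  = contradiction e ¬e

  extendByZero-off : ∀ {n k} (g : KSubset n k → ℤ) → SupportedOn k (extendByZero g)
  extendByZero-off {k = k} g S ne with ∣ S ∣ ℕ.≟ k
  ... | yes e = contradiction e ne
  ... | no _  = refl

  extendByZero-unique : ∀ {n k} (g : KSubset n k → ℤ) (f : Fn n) → SupportedOn k f →
                        (∀ v → f (proj₁ v) ≡ g v) → extendByZero g ≗ f
  extendByZero-unique {k = k} g f supp e S with ∣ S ∣ ℕ.≟ k
  ... | yes p = sym (e (S , p))
  ... | no ¬p = sym (supp S ¬p)

  indicator : ∀ {n k} → Subset (#KSubset n k) → Fn n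
  indicator X = extendByZero (λ v → χ (lookup X (vertexIndex v)))

  ∣++∣ : ∀ {m n} (p : Subset m) (q : Subset n) → ∣ p ++ q ∣ ≡ ∣ p ∣ ℕ.+ ∣ q ∣
  ∣++∣ []          q = refl
  ∣++∣ (true ∷ p)  q = cong suc (∣++∣ p q)
  ∣++∣ (false ∷ p) q = ∣++∣ p q

  -- The recursion follows `KSubset↔Fin`: the bits of X split into those of the k-sets through the
  -- first point and those of the (k+1)-sets avoiding it.
  ∑-indicator : ∀ n k (X : Subset (#KSubset n k)) → ∑ (indicator {n} {k} X) ≡ + ∣ X ∣
  ∑-indicator zero    zero    (true ∷ [])  = refl
  ∑-indicator zero    zero    (false ∷ []) = refl
  ∑-indicator zero    (suc k) []           = refl
  ∑-indicator (suc n) zero    X = trans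
    (cong₂ _+_ (∑-zero {n} (λ S →
        extendByZero-off {suc n} {0} (λ v → χ (lookup X (vertexIndex {suc n} {0} v))) (true ∷ S) (λ ())))
      (trans (∑-cong {n} (λ S → sym (extendByZero-unique _ (slice false (indicator {suc n} {0} X))
          (λ T → extendByZero-off {suc n} {0} _ (false ∷ T))
          (λ v → extendByZero-at {suc n} {0} _ (false ∷ proj₁ v , proj₂ v)) S)))
        (∑-indicator n zero X)))
    (+-identityˡ (+ ∣ X ∣))
  ∑-indicator (suc n) (suc k) X with splitAt (#KSubset n k) X
  ... | Y , Z , refl = trans
    (cong₂ _+_
      (trans (∑-cong {n} (λ S → sym (extendByZero-unique _ (slice true (indicator {suc n} {suc k} (Y ++ Z)))
          (λ T ne → extendByZero-off {suc n} {suc k} _ (true ∷ T) (ne ∘ ℕ.suc-injective))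
          (λ v → trans (extendByZero-at {suc n} {suc k} _ (true ∷ proj₁ v , cong suc (proj₂ v)))
            (cong χ (trans (lookup-++ˡ Y Z _) (cong (λ u → lookup Y (vertexIndex {n} {k} u)) (KSubset-≡ refl))))) S)))
        (∑-indicator n k Y))
      (trans (∑-cong {n} (λ S → sym (extendByZero-unique _ (slice false (indicator {suc n} {suc k} (Y ++ Z)))
          (λ T → extendByZero-off {suc n} {suc k} _ (false ∷ T))
          (λ v → trans (extendByZero-at {suc n} {suc k} _ (false ∷ proj₁ v , proj₂ v))
            (cong χ (lookup-++ʳ Y Z _))) S)))
        (∑-indicator n (suc k) Z)))
    (cong +_ (sym (∣++∣ Y Z)))

  -- The (S, T) entry of the tensor power of m; for `aᵐ` it is the adjacency matrix of disjointness.
  kernel : ∀ {n} → Matrix → Subset n → Subset n → ℤ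
  kernel m []      []      = 1ℤ
  kernel m (x ∷ S) (y ∷ T) = m x y * kernel m S T

  ∑-kernel : ∀ {n} m (f : Fn n) S → ∑ (λ T → kernel m S T * f T) ≡ tens m f S
  ∑-kernel m f []      = *-identityˡ (f [])
  ∑-kernel {suc n} m f (x ∷ S) = cong₂ _+_ (half true) (half false)
    where
    half : ∀ y → ∑ (λ T → m x y * kernel m S T * f (y ∷ T)) ≡ m x y * tens m (slice y f) S
    half y = trans (∑-cong {n} (λ T → *-assoc (m x y) (kernel m S T) (f (y ∷ T))))
      (trans (∑-scale {n} (m x y) _) (cong (λ t → m x y * t) (∑-kernel m (slice y f) S)))

  kernel-disjoint : ∀ {n} (S T : Subset n) → Disjoint S T → kernel aᵐ S T ≡ 1ℤ
  kernel-disjoint []          []          d = refl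
  kernel-disjoint (true ∷ S)  (true ∷ T)  d = contradiction (zero , here) d
  kernel-disjoint (true ∷ S)  (false ∷ T) d =
    trans (*-identityˡ _) (kernel-disjoint S T (λ (i , p) → d (suc i , there p)))
  kernel-disjoint (false ∷ S) (true ∷ T)  d =
    trans (*-identityˡ _) (kernel-disjoint S T (λ (i , p) → d (suc i , there p)))
  kernel-disjoint (false ∷ S) (false ∷ T) d =
    trans (*-identityˡ _) (kernel-disjoint S T (λ (i , p) → d (suc i , there p)))

  kernel-intersecting : ∀ {n} (S T : Subset n) → Nonempty (S ∩ T) → kernel aᵐ S T ≡ 0ℤ
  kernel-intersecting (true ∷ S) (true ∷ T) _ = *-zeroˡ (kernel aᵐ S T)
  kernel-intersecting (true ∷ S) (false ∷ T) (suc i , there p)  = trans (*-identityˡ _) (kernel-intersecting S T (i , p))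
  kernel-intersecting (false ∷ S) (true ∷ T) (suc i , there p)  = trans (*-identityˡ _) (kernel-intersecting S T (i , p))
  kernel-intersecting (false ∷ S) (false ∷ T) (suc i , there p) = trans (*-identityˡ _) (kernel-intersecting S T (i , p))

  -- A parity criterion for graphs with regular maximum independent sets.

  module _ (G : Graph) where
    open Graph G

    α≡ : ∀ {M} → (∀ {X} → Independent X → ∣ X ∣ ℕ.≤ M) → ∀ {Y} → Independent Y → ∣ Y ∣ ≡ M → α G ≡ M
    α≡ bound ind size = ℕ.≤-antisym
      (let _ , ind′ , size′ = maxSize-attained independent? ∅-independent in subst (ℕ._≤ _) size′ (bound ind′))
      (subst (ℕ._≤ α G) size (maxSize-upper independent? ind))

    α-od≤α : α-od G ℕ.≤ α G
    α-od≤α = let _ , (ind , _) , size = maxSize-attained oddIndependent? ∅-oddIndependent in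
      subst (ℕ._≤ α G) size (maxSize-upper independent? ind)

    -- When l is odd, any maximum independent set meets the odd condition. When l is even, a vertex
    -- outside an odd independent set of size M would have l ≠ 0 neighbours in it, an even number;
    -- so there is no such vertex, contradicting properness. Arguing this way, by decidability of
    -- parity, avoids producing an outside vertex.
    α-od≡α⇔ : ∀ {M l} → (∀ {X} → Independent X → ∣ X ∣ ℕ.≤ M) →
               (∀ {X} → Independent X → ∣ X ∣ ≡ M → ∀ v → v ∉ᵥ X → ∣ neighbours v ∩ X ∣ ≡ l) →
               (∀ {X} → ∣ X ∣ ≡ M → ¬ (∀ v → v ∈ᵥ X)) → l ≢ 0 →
               ∀ {Y} → Independent Y → ∣ Y ∣ ≡ M → α-od G ≡ α G ⇔ Odd l
    α-od≡α⇔ {M} {l} bound regular proper l≢0 {Y} indY sizeY = mk⇔ to from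
      where
      α≡M : α G ≡ M
      α≡M = α≡ bound indY sizeY

      all-members : ¬ Odd l → ∀ {X} → OddIndependent X → ∣ X ∣ ≡ M → ∀ v → v ∈ᵥ X
      all-members ¬odd {X} (ind , odd) size v with index v ∈? X
      ... | yes v∈ = v∈
      ... | no v∉  = ⊥-elim ([ (λ z → l≢0 (trans (sym (regular ind size v v∉)) z))
                             , (λ o → ¬odd (subst Odd (regular ind size v v∉) o)) ]′ (odd v v∉))

      to : α-od G ≡ α G → Odd l
      to e = decidable-stable (l % 2 ℕ.≟ 1) λ ¬odd →
        let X , odd , size = maxSize-attained oddIndependent? ∅-oddIndependent
            size≡M = trans size (trans e α≡M)
        in proper size≡M (all-members ¬odd odd size≡M)

      from : Odd l → α-od G ≡ α G
      from odd = ℕ.≤-antisym α-od≤α (subst (ℕ._≤ α-od G) (trans sizeY (sym α≡M)) (maxSize-upper oddIndependent?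
        (indY , λ v v∉ → inj₂ (subst Odd (sym (regular indY sizeY v v∉)) odd))))

  -- Neighbour counts in the Kneser graph as disjoint sums.

  module Kneser (n k : ℕ) where
    open Graph (KG n (suc k)) public

    𝟙 : VertexSet → Fn n
    𝟙 = indicator {n} {suc k}

    ¬disjoint-self : ∀ (v : Vertex) → ¬ Disjoint (proj₁ v) (proj₁ v)
    ¬disjoint-self (S , e) d = contradiction
      (trans (sym e) (trans (cong ∣_∣ (Empty-unique (subst Empty (∩-idem S) d))) (∣⊥∣≡0 n))) (λ ())

    adjacency : ∀ u v → χ (does (u ~? v)) ≡ kernel aᵐ (proj₁ u) (proj₁ v)
    adjacency u v = χ-does (u ~? v) (λ u~v → kernel-disjoint (proj₁ u) (proj₁ v) (proj₂ u~v)) nonadjacent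
      where
      nonadjacent : ¬ (u ~ v) → kernel aᵐ (proj₁ u) (proj₁ v) ≡ 0ℤ
      nonadjacent ¬u~v with nonempty? (proj₁ u ∩ proj₁ v)
      ... | yes ne = kernel-intersecting (proj₁ u) (proj₁ v) ne
      ... | no ¬ne = contradiction ((λ { refl → ¬disjoint-self u ¬ne }) , ¬ne) ¬u~v

    lookup-vertices : ∀ (b : Vertex → Bool) v → lookup (tabulate (λ i → b (vertex i))) (index v) ≡ b v
    lookup-vertices b v = trans (lookup∘tabulate (λ i → b (vertex i)) (index v))
      (cong b (Inverse.strictlyInverseʳ indexing v))

    indicator-at : ∀ (X : VertexSet) v → 𝟙 X (proj₁ v) ≡ χ (lookup X (index v))
    indicator-at X v = extendByZero-at (λ u → χ (lookup X (index u))) v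

    indicator-supported : ∀ (X : VertexSet) → SupportedOn (suc k) (𝟙 X)
    indicator-supported X = extendByZero-off (λ u → χ (lookup X (index u)))

    neighbour-count : ∀ (X : VertexSet) v → + ∣ neighbours v ∩ X ∣ ≡ disjointSum (𝟙 X) (proj₁ v)
    neighbour-count X v = begin
      + ∣ neighbours v ∩ X ∣                             ≡⟨ ∑-indicator n (suc k) (neighbours v ∩ X) ⟨
      ∑ (𝟙 (neighbours v ∩ X))       ≡⟨ ∑-cong {n} (extendByZero-unique _ _ supp at) ⟩
      ∑ (λ T → kernel aᵐ (proj₁ v) T * 𝟙 X T)  ≡⟨ ∑-kernel aᵐ (𝟙 X) (proj₁ v) ⟩
      disjointSum (𝟙 X) (proj₁ v)    ∎
      where
      supp : SupportedOn (suc k) (λ T → kernel aᵐ (proj₁ v) T * 𝟙 X T)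
      supp T ne = trans (cong (λ t → kernel aᵐ (proj₁ v) T * t) (indicator-supported X T ne)) (*-zeroʳ (kernel aᵐ (proj₁ v) T))
      at : ∀ u → kernel aᵐ (proj₁ v) (proj₁ u) * 𝟙 X (proj₁ u) ≡ χ (lookup (neighbours v ∩ X) (index u))
      at u = begin
        kernel aᵐ (proj₁ v) (proj₁ u) * 𝟙 X (proj₁ u)
          ≡⟨ cong₂ _*_ (sym (adjacency v u)) (indicator-at X u) ⟩
        χ (does (v ~? u)) * χ (lookup X (index u))
          ≡⟨ χ-∧ (does (v ~? u)) (lookup X (index u)) ⟨
        χ (does (v ~? u) ∧ lookup X (index u))
          ≡⟨ cong (λ b → χ (b ∧ lookup X (index u))) (lookup-vertices (λ u → does (v ~? u)) u) ⟨
        χ (lookup (neighbours v) (index u) ∧ lookup X (index u))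
          ≡⟨ cong χ (lookup-zipWith _∧_ (index u) (neighbours v) X) ⟨
        χ (lookup (neighbours v ∩ X) (index u)) ∎

    indicator-idempotent : ∀ (X : VertexSet) S → 𝟙 X S * 𝟙 X S ≡ 𝟙 X S
    indicator-idempotent X S with ∣ S ∣ ℕ.≟ suc k
    ... | yes e = χ-idem (lookup X (index (S , e)))
    ... | no ¬e = refl

    indicator-independent : ∀ {X : VertexSet} → Independent X → ∀ S →
                            𝟙 X S * disjointSum (𝟙 X) S ≡ 0ℤ
    indicator-independent {X} ind S with ∣ S ∣ ℕ.≟ suc k
    ... | no ¬e = *-zeroˡ (disjointSum (𝟙 X) S)
    ... | yes e with lookup X (index (S , e)) in eq
    ...   | false = *-zeroˡ (disjointSum (𝟙 X) S)
    ...   | true  = trans (*-identityˡ _) (trans (sym (∑-kernel aᵐ (𝟙 X) S)) (∑-zero {n} term))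
      where
      u∈X : (S , e) ∈ᵥ X
      u∈X = lookup⇒[]= (index (S , e)) X eq
      term : ∀ T → kernel aᵐ S T * 𝟙 X T ≡ 0ℤ
      term T with ∣ T ∣ ℕ.≟ suc k
      ... | no _   = *-zeroʳ (kernel aᵐ S T)
      ... | yes e′ with lookup X (index (T , e′)) in eq′
      ...   | false = *-zeroʳ (kernel aᵐ S T)
      ...   | true  = trans (*-identityʳ (kernel aᵐ S T)) (trans (sym (adjacency (S , e) (T , e′)))
        (χ-does ((S , e) ~? (T , e′)) (λ a → contradiction a (ind _ _ u∈X (lookup⇒[]= (index (T , e′)) X eq′))) (λ _ → refl)))

  -- Maximum independent sets of the Kneser graph.

  module _ {k m : ℕ} (k≤m : k ℕ.≤ m) where
    open Kneser (suc k ℕ.+ suc m) k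

    private
      G : Graph
      G = KG (suc k ℕ.+ suc m) (suc k)

    intersecting-bound : ∀ {X} → Independent X → ∣ X ∣ ℕ.≤ (k ℕ.+ suc m) C k
    intersecting-bound {X} ind = size-bound ∣ X ∣ (∑-indicator (suc k ℕ.+ suc m) (suc k) X)
      where open RatioBound k≤m (𝟙 X) (indicator-supported X) (indicator-idempotent X) (indicator-independent ind)

    extremal-neighbours : ∀ {X} → Independent X → ∣ X ∣ ≡ (k ℕ.+ suc m) C k →
                          ∀ v → v ∉ᵥ X → ∣ neighbours v ∩ X ∣ ≡ m C k
    extremal-neighbours {X} ind size v v∉X = +-injective (trans (neighbour-count X v)
      (tight (trans (∑-indicator (suc k ℕ.+ suc m) (suc k) X) (cong +_ size)) (proj₁ v) (proj₂ v)
        (trans (indicator-at X v) absent)))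
      where
      open RatioBound k≤m (𝟙 X) (indicator-supported X) (indicator-idempotent X) (indicator-independent ind)
      absent : χ (lookup X (index v)) ≡ 0ℤ
      absent with lookup X (index v) in eq
      ... | true  = contradiction (lookup⇒[]= (index v) X eq) v∉X
      ... | false = refl

    star : VertexSet
    star = tabulate (λ i → head (proj₁ (vertex i)))

    star-independent : Independent star
    star-independent u v u∈ v∈ (_ , d) = d (zero , x∈p∩q⁺ (contains u u∈ , contains v v∈))
      where
      contains : ∀ u → u ∈ᵥ star → zero ∈ₛ proj₁ u
      contains (x ∷ S , e) u∈ with trans (sym (lookup-vertices (head ∘ proj₁) (x ∷ S , e))) ([]=⇒lookup u∈)
      ... | refl = here

    star-size : ∣ star ∣ ≡ (k ℕ.+ suc m) C k
    star-size = +-injective (begin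
      + ∣ star ∣                              ≡⟨ ∑-indicator (suc k ℕ.+ suc m) (suc k) star ⟨
      ∑ (indicator {suc k ℕ.+ suc m} {suc k} star)
        ≡⟨ ∑-cong {suc k ℕ.+ suc m} (extendByZero-unique _ g supp at) ⟩
      ∑ (slice true g) + ∑ (slice false g)
        ≡⟨ cong₂ _+_ (∑-level-one (k ℕ.+ suc m) k) (∑-zero {k ℕ.+ suc m} (λ _ → refl)) ⟩
      + ((k ℕ.+ suc m) C k) + 0ℤ              ≡⟨ +-identityʳ _ ⟩
      + ((k ℕ.+ suc m) C k)                   ∎)
      where
      g : Fn (suc k ℕ.+ suc m)
      g (true ∷ S)  = level k (λ _ → 1ℤ) S
      g (false ∷ S) = 0ℤ
      supp : SupportedOn (suc k) g
      supp (true ∷ S)  ne = level-off k (λ _ → 1ℤ) S (ne ∘ cong suc)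
      supp (false ∷ S) ne = refl
      at : ∀ v → g (proj₁ v) ≡ χ (lookup star (index v))
      at v@(true ∷ S , e)  = trans (level-at k (λ _ → 1ℤ) S (ℕ.suc-injective e))
        (cong χ (sym (lookup-vertices (head ∘ proj₁) v)))
      at v@(false ∷ S , e) = cong χ (sym (lookup-vertices (head ∘ proj₁) v))

    full-size : ∀ {X} → (∀ v → v ∈ᵥ X) → ∣ X ∣ ≡ (suc k ℕ.+ suc m) C suc k
    full-size {X} all = +-injective (begin
      + ∣ X ∣                                           ≡⟨ ∑-indicator (suc k ℕ.+ suc m) (suc k) X ⟨
      ∑ (indicator {suc k ℕ.+ suc m} {suc k} X)
        ≡⟨ ∑-cong {suc k ℕ.+ suc m} (extendByZero-unique _ (level (suc k) (λ _ → 1ℤ)) (level-off (suc k) (λ _ → 1ℤ))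
             (λ v → trans (level-at (suc k) (λ _ → 1ℤ) (proj₁ v) (proj₂ v)) (cong χ (sym ([]=⇒lookup (all v)))))) ⟩
      ∑ {suc k ℕ.+ suc m} (level (suc k) (λ _ → 1ℤ))     ≡⟨ ∑-level-one (suc k ℕ.+ suc m) (suc k) ⟩
      + ((suc k ℕ.+ suc m) C suc k)                     ∎)

    -- The difference is C(n - 1, k + 1) > 0 by Pascal's rule. Hence a set as large as a star always
    -- misses a vertex, the properness that `α-od≡α⇔` asks for.
    star<full : (k ℕ.+ suc m) C k ℕ.< (suc k ℕ.+ suc m) C suc k
    star<full = ℕ.<-≤-trans (ℕ.m<m+n _ (C-positive (ℕ.≤-trans (s≤s k≤m) (ℕ.m≤n+m (suc m) k))))
      (ℕ.≤-reflexive (nCk+nC[k+1]≡[n+1]C[k+1] (k ℕ.+ suc m) k))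

    α-od≡α⇔odd : α-od G ≡ α G ⇔ Odd (m C k)
    α-od≡α⇔odd = α-od≡α⇔ G intersecting-bound extremal-neighbours
      (λ size all → ℕ.<⇒≢ star<full (trans (sym size) (full-size all)))
      (ℕ.>⇒≢ (C-positive k≤m)) star-independent star-size

  -- Vandermonde's identity and parity.

  sum-applyUpTo-last : ∀ k (f : ℕ → ℕ) → sum (applyUpTo f (suc k)) ≡ sum (applyUpTo f k) ℕ.+ f k
  sum-applyUpTo-last zero    f = ℕ.+-identityʳ (f 0)
  sum-applyUpTo-last (suc k) f = trans (cong (f 0 ℕ.+_) (sum-applyUpTo-last k (f ∘ suc)))
    (sym (ℕ.+-assoc (f 0) (sum (applyUpTo (f ∘ suc) k)) (f (suc k))))

  sum-applyUpTo-cong : ∀ k {f g : ℕ → ℕ} → (∀ t → f t ≡ g t) → sum (applyUpTo f k) ≡ sum (applyUpTo g k)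
  sum-applyUpTo-cong zero    e = refl
  sum-applyUpTo-cong (suc k) e = cong₂ ℕ._+_ (e 0) (sum-applyUpTo-cong k (e ∘ suc))

  sum-applyUpTo-+ : ∀ k (f g : ℕ → ℕ) →
                    sum (applyUpTo (λ t → f t ℕ.+ g t) k) ≡ sum (applyUpTo f k) ℕ.+ sum (applyUpTo g k)
  sum-applyUpTo-+ zero    f g = refl
  sum-applyUpTo-+ (suc k) f g = trans (cong (f 0 ℕ.+ g 0 ℕ.+_) (sum-applyUpTo-+ k (f ∘ suc) (g ∘ suc)))
    (identity (f 0) (g 0) (sum (applyUpTo (f ∘ suc) k)) (sum (applyUpTo (g ∘ suc) k)))
    where
    identity : ∀ a b c d → a ℕ.+ b ℕ.+ (c ℕ.+ d) ≡ a ℕ.+ c ℕ.+ (b ℕ.+ d)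
    identity = ℕ-Solver.solve-∀

  binomial-sum-suc : ∀ k (x : ℕ → ℕ) →
                     sum (applyUpTo (λ t → (suc k C t) ℕ.* x t) (suc (suc k))) ≡
                     sum (applyUpTo (λ t → (k C t) ℕ.* x (suc t)) (suc k)) ℕ.+
                     sum (applyUpTo (λ t → (k C t) ℕ.* x t) (suc k))
  binomial-sum-suc k x = begin
    (suc k C 0) ℕ.* x 0 ℕ.+ sum (applyUpTo (λ t → (suc k C suc t) ℕ.* x (suc t)) (suc k))
      ≡⟨ cong₂ ℕ._+_ (cong (ℕ._* x 0) (trans (nC0≡1 (suc k)) (sym (nC0≡1 k))))
           (trans (sum-applyUpTo-cong (suc k) (λ t → trans (cong (ℕ._* x (suc t)) (sym (nCk+nC[k+1]≡[n+1]C[k+1] k t)))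
                     (ℕ.*-distribʳ-+ (x (suc t)) (k C t) (k C suc t))))
             (sum-applyUpTo-+ (suc k) (λ t → (k C t) ℕ.* x (suc t)) (λ t → (k C suc t) ℕ.* x (suc t)))) ⟩
    (k C 0) ℕ.* x 0 ℕ.+ (shifted ℕ.+ sum (applyUpTo (λ t → (k C suc t) ℕ.* x (suc t)) (suc k)))
      ≡⟨ identity ((k C 0) ℕ.* x 0) shifted _ ⟩
    shifted ℕ.+ sum (applyUpTo (λ t → (k C t) ℕ.* x t) (suc (suc k)))
      ≡⟨ cong (shifted ℕ.+_) (sum-applyUpTo-last (suc k) (λ t → (k C t) ℕ.* x t)) ⟩
    shifted ℕ.+ (sum (applyUpTo (λ t → (k C t) ℕ.* x t) (suc k)) ℕ.+ (k C suc k) ℕ.* x (suc k))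
      ≡⟨ cong (λ c → shifted ℕ.+ (sum (applyUpTo (λ t → (k C t) ℕ.* x t) (suc k)) ℕ.+ c ℕ.* x (suc k)))
              (k>n⇒nCk≡0 {k} {suc k} (ℕ.n<1+n k)) ⟩
    shifted ℕ.+ (sum (applyUpTo (λ t → (k C t) ℕ.* x t) (suc k)) ℕ.+ 0)
      ≡⟨ cong (shifted ℕ.+_) (ℕ.+-identityʳ _) ⟩
    shifted ℕ.+ sum (applyUpTo (λ t → (k C t) ℕ.* x t) (suc k)) ∎
    where
    shifted : ℕ
    shifted = sum (applyUpTo (λ t → (k C t) ℕ.* x (suc t)) (suc k))
    identity : ∀ a b c → a ℕ.+ (b ℕ.+ c) ≡ b ℕ.+ (a ℕ.+ c)
    identity = ℕ-Solver.solve-∀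

  pascalᶻ : ∀ m r → (m Cᶻ (r - + 1)) ℕ.+ (m Cᶻ r) ≡ suc m Cᶻ r
  pascalᶻ m (+ zero)  = trans (nC0≡1 m) (sym (nC0≡1 (suc m)))
  pascalᶻ m (+ suc j) = nCk+nC[k+1]≡[n+1]C[k+1] m j
  pascalᶻ m -[1+ j ]  = refl

  -- Induction on k by Pascal's rule in the first factor. The lower index r is an integer because
  -- the step passes to r - 1, which may be negative; with the value 0 there, Pascal's rule holds
  -- for every r.
  vandermonde : ∀ k m r → sum (applyUpTo (λ t → (k C t) ℕ.* (m Cᶻ (r - + t))) (suc k)) ≡ (k ℕ.+ m) Cᶻ r
  vandermonde zero    m r = trans (ℕ.+-identityʳ _) (trans (ℕ.+-identityʳ _) (cong (m Cᶻ_) (+-identityʳ r)))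
  vandermonde (suc k) m r = begin
    sum (applyUpTo (λ t → (suc k C t) ℕ.* (m Cᶻ (r - + t))) (suc (suc k)))
      ≡⟨ binomial-sum-suc k (λ t → m Cᶻ (r - + t)) ⟩
    sum (applyUpTo (λ t → (k C t) ℕ.* (m Cᶻ (r - + suc t))) (suc k)) ℕ.+
    sum (applyUpTo (λ t → (k C t) ℕ.* (m Cᶻ (r - + t))) (suc k))
      ≡⟨ cong₂ ℕ._+_
           (trans (sum-applyUpTo-cong (suc k) (λ t → cong (λ z → (k C t) ℕ.* (m Cᶻ z)) (identity r (+ t))))
             (vandermonde k m (r - + 1)))
           (vandermonde k m r) ⟩
    ((k ℕ.+ m) Cᶻ (r - + 1)) ℕ.+ ((k ℕ.+ m) Cᶻ r)
      ≡⟨ pascalᶻ (k ℕ.+ m) r ⟩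
    suc (k ℕ.+ m) Cᶻ r ∎
    where
    identity : ∀ r t → r - (+ 1 + t) ≡ (r - + 1) - t
    identity = solve-∀

  -- The term t = 0 of Vandermonde's sum is the binomial whose parity decides the first criterion,
  -- so the second compares the total with the remaining terms.
  vandermonde-split : ∀ k m → (k ℕ.+ suc m) C k ≡
                      (m C k) ℕ.+ ∑[1⋯ suc k ] (λ t → (suc k C t) ℕ.* (m Cᶻ (+ suc k - + 1 - + t)))
  vandermonde-split k m = begin
    (k ℕ.+ suc m) C k   ≡⟨ cong (_C k) (ℕ.+-suc k m) ⟩
    (suc k ℕ.+ m) C k   ≡⟨ vandermonde (suc k) m (+ k) ⟨
    (suc k C 0) ℕ.* (m C (k ℕ.+ 0)) ℕ.+ tail
      ≡⟨ cong (ℕ._+ tail) (trans (cong₂ ℕ._*_ (nC0≡1 (suc k)) (cong (m C_) (ℕ.+-identityʳ k))) (ℕ.*-identityˡ (m C k))) ⟩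
    (m C k) ℕ.+ tail    ∎
    where
    tail : ℕ
    tail = ∑[1⋯ suc k ] (λ t → (suc k C t) ℕ.* (m Cᶻ (+ suc k - + 1 - + t)))

  odd-summand : ∀ a b → Odd a ⇔ (a ℕ.+ b) % 2 ≢ b % 2
  odd-summand a b = mk⇔
    (λ odd e → clash (b % 2) (m%n<n b 2)
      (trans (sym (trans (%-distribˡ-+ a b 2) (cong (λ x → (x ℕ.+ b % 2) % 2) odd))) e))
    (λ ne → odd-of (a % 2) (m%n<n a 2) (λ a≡0 → ne
      (trans (%-distribˡ-+ a b 2) (trans (cong (λ x → (x ℕ.+ b % 2) % 2) a≡0) (mod-mod (b % 2) (m%n<n b 2))))))
    where
    clash : ∀ x → x ℕ.< 2 → (1 ℕ.+ x) % 2 ≢ x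
    clash 0 _ ()
    clash 1 _ ()
    clash (suc (suc _)) (s≤s (s≤s ()))
    odd-of : ∀ x → x ℕ.< 2 → x ≢ 0 → x ≡ 1
    odd-of 0 _ ne = contradiction refl ne
    odd-of 1 _ _  = refl
    odd-of (suc (suc _)) (s≤s (s≤s ())) _
    mod-mod : ∀ x → x ℕ.< 2 → x % 2 ≡ x
    mod-mod 0 _ = refl
    mod-mod 1 _ = refl
    mod-mod (suc (suc _)) (s≤s (s≤s ()))

open import Data.Integer using (+_; _-_)
open import Data.Nat using (ℕ; zero; suc; s≤s; _*_; _∸_; _≤_)
open ErdősKoRado using (α-od≡α⇔odd; vandermonde-split; odd-summand)

theorem2 : (k n : ℕ) → 2 ≤ k → 2 * k ≤ n →
  (α-od (KG n k) ≡ α (KG n k) ⇔ Odd ((n ∸ k ∸ 1) C (k ∸ 1)))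
  ×
  (α-od (KG n k) ≡ α (KG n k) ⇔
    ((n ∸ 1) C (k ∸ 1)) % 2 ≢ (∑[1⋯ k ] (λ t → (k C t) * ((n ∸ k ∸ 1) Cᶻ (+ k - + 1 - + t)))) % 2)
theorem2 (suc k) n 2≤k 2k≤n = reduce n (n ℕ.∸ suc k) (sym (ℕ.m+[n∸m]≡n k≤n)) k≤n∸k
  where
  k+k≤n : suc k ℕ.+ suc k ℕ.≤ n
  k+k≤n = subst (ℕ._≤ n) (cong (suc k ℕ.+_) (ℕ.+-identityʳ (suc k))) 2k≤n
  k≤n : suc k ℕ.≤ n
  k≤n = ℕ.≤-trans (ℕ.m≤m+n (suc k) (suc k)) k+k≤n
  k≤n∸k : suc k ℕ.≤ n ℕ.∸ suc k
  k≤n∸k = subst (ℕ._≤ n ℕ.∸ suc k) (ℕ.m+n∸n≡m (suc k) (suc k)) (ℕ.∸-monoˡ-≤ (suc k) k+k≤n)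
  -- The difference n ∸ suc k is abstracted to d, so that matching on `refl` turns n into (k + 1) +
  -- (m + 1) and the subtractions compute.
  reduce : ∀ n d → n ≡ suc k ℕ.+ d → suc k ℕ.≤ d →
    (α-od (KG n (suc k)) ≡ α (KG n (suc k)) ⇔ Odd ((d ℕ.∸ 1) C k))
    ×
    (α-od (KG n (suc k)) ≡ α (KG n (suc k)) ⇔
    ((n ℕ.∸ 1) C k) % 2 ≢ (∑[1⋯ suc k ] (λ t → (suc k C t) ℕ.* ((d ℕ.∸ 1) Cᶻ (+ suc k - + 1 - + t)))) % 2)
  reduce n (suc m) refl (s≤s k≤m) =
    main , mk⇔ (λ eq → subst Distinct (sym (vandermonde-split k m)) (Equivalence.to parity (Equivalence.to main eq)))
               (λ ne → Equivalence.from main (Equivalence.from parity (subst Distinct (vandermonde-split k m) ne)))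
    where
    tail : ℕ
    tail = ∑[1⋯ suc k ] (λ t → (suc k C t) ℕ.* (m Cᶻ (+ suc k - + 1 - + t)))
    Distinct : ℕ → Set
    Distinct x = x % 2 ≢ tail % 2
    main : α-od (KG (suc k ℕ.+ suc m) (suc k)) ≡ α (KG (suc k ℕ.+ suc m) (suc k)) ⇔ Odd (m C k)
    main = α-od≡α⇔odd k≤m
    parity : Odd (m C k) ⇔ (m C k ℕ.+ tail) % 2 ≢ tail % 2
    parity = odd-summand (m C k) tail
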